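{- There is a polynomial $p$ such that for every $n\ge 2$ and every choice of guard functions $r,s$ (as in the context), the guarded graph tautology formula $\mathrm{GGT}_n$ has a pool resolution (regRTL) refutation with at most $p(n)$ clauses.
   Context: Clauses are sets of literals (disjunctions); a resolution inference derives $A'\lor B'$ from $A'\lor x$ and $B'\lor \overline{x}$ (with $\overline x\notin A'$, $x\notin B'$), resolving on the variable $x$. A pool resolution (regRTL) refutation of a set $F$ of clauses is a finite binary tree $T$ whose nodes are labeled by clauses such that: the root is labeled with the empty clause; each internal node is labeled with a clause obtained by a resolution inference from the clauses of its two children, together with the resolution variable; each leaf is labeled either with a clause of $F$ or with a clause ("lemma") that labels some node occurring earlier than that leaf in the postorder of $T$ (postorder: for a node $u$, every node $v$ in the subtree of the left child of $u$ and every node $w$ in the subtree of the right child satisfy $v<w<u$); and the tree is regular, i.e. along every path from the root to a leaf, each variable is used as a resolution variable at most once. Graph tautology variables: for $[n]=\{0,\dots,n-1\}$ there are variables $x_{i,j}$ for $i<j$ in $[n]$, and for $i>j$ the notation $x_{i,j}$ denotes the literal $\overline{x}_{j,i}$ (so $\overline x_{i,j}$ and $x_{j,i}$ are the same literal). For distinct $i,j,k$, $T_{i,j,k}$ is the clause $\overline x_{i,j}\lor\overline x_{j,k}\lor\overline x_{k,i}$. Let $r,s:[n]^3\to[n]$ be functions such that for all distinct $i,j,k$: $r(i,j,k)\neq s(i,j,k)$, $\{r(i,j,k),s(i,j,k)\}\not\subseteq\{i,j,k\}$, and $r(i,j,k)=r(j,k,i)=r(k,i,j)$, $s(i,j,k)=s(j,k,i)=s(k,i,j)$.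 The formula $\mathrm{GGT}_n$ consists of the clauses $\bigvee_{j\ne i}x_{j,i}$ for each $i\in[n]$, and, for all distinct $i,j,k\in[n]$ with $r=r(i,j,k)$, $s=s(i,j,k)$, the two guarded transitivity clauses $T_{i,j,k}\lor x_{r,s}$ and $T_{i,j,k}\lor\overline x_{r,s}$. -}

module Defs where

open import Data.Nat as ℕ using (ℕ; _+_; _*_; _^_; _<ᵇ_)
open import Data.Fin using (Fin; toℕ)
open import Data.Fin.Properties using (_≟_)
open import Data.Bool using (Bool; true; false; not; if_then_else_)
open import Data.List using (List; []; _∷_; _++_; concatMap; [_])
open import Data.List.Base using (allFin)
open import Data.List.Membership.Propositional using (_∈_; _∉_)
open import Data.List.Relation.Unary.Any using (Any)
open import Data.List.Relation.Binary.BagAndSetEquality using (_∼[_]_; set)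
open import Data.Product using (Σ; _×_; ∃; ∃-syntax; _,_)
open import Data.Sum using (_⊎_)
open import Data.Unit using (⊤)
open import Relation.Nullary using (¬_; does)
open import Relation.Binary.PropositionalEquality using (_≡_; _≢_)

Lit : Set → Set
Lit V = V × Bool

pos : {V : Set} → V → Lit V
pos x = x , true

neg : {V : Set} → V → Lit V
neg x = x , false

compl : {V : Set} → Lit V → Lit V
compl (x , b) = x , not b

-- Clauses are sets of literals, represented as lists up to set equality.
Clause : Set → Set
Clause V = List (Lit V)

_≈_ : {V : Set} → Clause V → Clause V → Set
C ≈ D = C ∼[ set ] D

Resolves : {V : Set} → V → Clause V → Clause V → Clause V → Set
Resolves x A B C =
  Σ (Clause _) λ A' → Σ (Clause _) λ B' →
    (A ≈ (pos x ∷ A')) × (B ≈ (neg x ∷ B')) ×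
    (neg x ∉ A') × (pos x ∉ B') × (C ≈ (A' ++ B'))

data Tree (V : Set) : Set where
  leaf : Clause V → Tree V
  node : Clause V → V → Tree V → Tree V → Tree V

label : {V : Set} → Tree V → Clause V
label (leaf C)       = C
label (node C _ _ _) = C

postorder : {V : Set} → Tree V → List (Clause V)
postorder (leaf C)       = [ C ]
postorder (node C _ l r) = postorder l ++ postorder r ++ [ C ]

size : {V : Set} → Tree V → ℕ
size (leaf _)       = 1
size (node _ _ l r) = size l + size r + 1

-- Local correctness. 'prior' are the labels of the nodes which precede
-- (the subtree rooted at) the current node in the postorder of the whole tree.
-- A leaf is a clause of F, or a lemma: a clause labelling an earlier node.
-- An internal node is obtained by resolution from its two children.
PoolValid : {V : Set} → (Clause V → Set) → List (Clause V) → Tree V → Set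
PoolValid F prior (leaf C) =
  (Σ (Clause _) λ D → F D × (C ≈ D)) ⊎ Any (λ D → C ≈ D) prior
PoolValid F prior (node C x l r) =
  PoolValid F prior l ×
  PoolValid F (prior ++ postorder l) r ×
  (Resolves x (label l) (label r) C ⊎ Resolves x (label r) (label l) C)

Regular : {V : Set} → List V → Tree V → Set
Regular used (leaf _)       = ⊤
Regular used (node _ x l r) = (x ∉ used) × Regular (x ∷ used) l × Regular (x ∷ used) r

PoolRefutation : {V : Set} → (Clause V → Set) → Tree V → Set
PoolRefutation F T = (label T ≡ []) × PoolValid F [] T × Regular [] T

Poly : Set
Poly = List ℕ

eval : Poly → ℕ → ℕ
eval []       n = 0
eval (a ∷ as) n = a + n * eval as n

-- Variable x_{i,j} (meant for i < j) is the pair (i , j).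
GVar : ℕ → Set
GVar n = Fin n × Fin n

x : {n : ℕ} → Fin n → Fin n → Lit (GVar n)
x i j = if toℕ i <ᵇ toℕ j then ((i , j) , true) else ((j , i) , false)

x̄ : {n : ℕ} → Fin n → Fin n → Lit (GVar n)
x̄ i j = compl (x i j)

Tr : {n : ℕ} → Fin n → Fin n → Fin n → Clause (GVar n)
Tr i j k = x̄ i j ∷ x̄ j k ∷ x̄ k i ∷ []

Wide : {n : ℕ} → Fin n → Clause (GVar n)
Wide {n} i = concatMap (λ j → if does (j ≟ i) then [] else [ x j i ]) (allFin n)

Distinct : {n : ℕ} → Fin n → Fin n → Fin n → Set
Distinct i j k = (i ≢ j) × (j ≢ k) × (i ≢ k)

Guard : ℕ → Set
Guard n = Fin n → Fin n → Fin n → Fin n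

In3 : {n : ℕ} → Fin n → Fin n → Fin n → Fin n → Set
In3 a i j k = (a ≡ i) ⊎ (a ≡ j) ⊎ (a ≡ k)

GuardConditions : (n : ℕ) → Guard n → Guard n → Set
GuardConditions n r s = ∀ (i j k : Fin n) → Distinct i j k →
  (r i j k ≢ s i j k) ×
  ¬ (In3 (r i j k) i j k × In3 (s i j k) i j k) ×
  (r i j k ≡ r j k i) × (r i j k ≡ r k i j) ×
  (s i j k ≡ s j k i) × (s i j k ≡ s k i j)

GGT : (n : ℕ) → Guard n → Guard n → Clause (GVar n) → Set
GGT n r s C =
  (∃[ i ] C ≡ Wide i) ⊎
  (∃[ i ] ∃[ j ] ∃[ k ] Distinct i j k ×
     ((C ≡ Tr i j k ++ [ x (r i j k) (s i j k) ]) ⊎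
      (C ≡ Tr i j k ++ [ x̄ (r i j k) (s i j k) ])))

-- The decisions made on the way to a node form a set of arcs i ⟶ j in which every vertex which
-- is not a root (that is, which is preceded by something) has a parent among the roots. If
-- every transitivity clause needed below such a node is either derived already or has its guard
-- decided, then the usual ordering refutation over the roots works: compare a candidate c for
-- the first vertex with the roots one by one, replacing it by k once k ⟶ c; the clauses "c is
-- not first among those seen so far" serve as lemmas. Otherwise some clause T(w,z,u) is missing
-- whose guard is still undecided: decide its literals so as to derive it here, and refute the
-- at most three alternative branches afterwards. In these, roots at most become children of
-- another root, so they are of the same form. Each clause is learned at most once,
-- hence at most 3n³ + 1 ordering refutations occur. No resolution is degenerate because the
-- clause refuted at a node contains i ⟶ y for every arc leaving a root i.

module Submission where

open import Defs
open import Data.Nat using (ℕ; zero; suc; _+_; _*_; _≤_; _<_; z≤n; s≤s; s≤s⁻¹; _<ᵇ_)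
open import Data.Nat.Properties
  using (<ᵇ⇒<; <⇒<ᵇ; <-asym; ≮⇒≥; ≤-antisym; ≤-refl; ≤-trans; ≤-reflexive; +-mono-≤; +-monoˡ-≤;
         +-monoʳ-≤; *-monoʳ-≤; *-monoˡ-≤; *-mono-≤; +-cancelˡ-≤; m≤m+n; m≤n+m; m≤n⇒m≤1+n; <-≤-trans; module ≤-Reasoning)
open import Data.Nat.Tactic.RingSolver using (solve-∀)
open import Data.Fin using (Fin; zero; toℕ)
open import Data.Fin.Properties using (_≟_; toℕ-injective; any?)
open import Data.Bool using (Bool; true; false; not; T; if_then_else_)
import Data.Bool.Properties as Bool
open import Data.List using (List; []; _∷_; _++_; map; filter; length; [_]; cartesianProduct)
open import Data.List.Base using (allFin)
import Data.List.Properties as List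
open import Data.List.Membership.Propositional using (_∈_; _∉_; find; lose)
open import Data.List.Membership.Propositional.Properties
  using (∈-map⁺; ∈-map⁻; ∈-++⁺ˡ; ∈-++⁺ʳ; ∈-++⁻; ∈-filter⁺; ∈-filter⁻; ∈-allFin; ∈-concatMap⁺; ∈-concatMap⁻; ∈-cartesianProduct⁺)
import Data.List.Membership.DecPropositional as DecMembership
open import Data.List.Relation.Unary.Any using (here; there; toSum)
open import Data.List.Relation.Unary.All using (All; []; _∷_)
import Data.List.Relation.Unary.All as All
open import Data.List.Relation.Unary.AllPairs using ([]; _∷_)
open import Data.List.Relation.Unary.Unique.Propositional using (Unique)
open import Data.List.Relation.Unary.Unique.Propositional.Properties using (allFin⁺; filter⁺)
open import Data.List.Relation.Binary.Subset.Propositional using (_⊆_)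
open import Data.List.Relation.Binary.Subset.Propositional.Properties using (xs⊆xs++ys; ++⁺ʳ)
open import Data.Product using (Σ; ∃; ∃-syntax; _×_; _,_; proj₁; proj₂)
import Data.Product.Properties as Product
open import Data.Sum using (_⊎_; inj₁; inj₂; [_,_]′)
import Data.Sum as Sum
open import Data.Unit using (⊤; tt)
open import Function using (_∘_; id; mk⇔)
open import Relation.Nullary using (¬_; Dec; yes; no; does; contradiction)
open import Relation.Nullary.Decidable using (¬?; _×-dec_; _⊎-dec_)
open import Relation.Unary using (Decidable)
open import Relation.Binary.Definitions using (DecidableEquality)
open import Relation.Binary.PropositionalEquality using (_≡_; _≢_; refl; sym; trans; cong; cong₂; subst; subst₂)

-- Counting list elements that satisfy a predicate.

module _ {A : Set} {P Q : A → Set} (P? : Decidable P) (Q? : Decidable Q) (Q⇒P : ∀ {x} → Q x → P x) where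

  length-filter-mono : ∀ xs → length (filter Q? xs) ≤ length (filter P? xs)
  length-filter-mono []       = z≤n
  length-filter-mono (x ∷ xs) with Q? x | P? x
  ... | yes q | yes p = s≤s (length-filter-mono xs)
  ... | yes q | no ¬p = contradiction (Q⇒P q) ¬p
  ... | no ¬q | yes p = m≤n⇒m≤1+n (length-filter-mono xs)
  ... | no ¬q | no ¬p = length-filter-mono xs

  length-filter-strict : ∀ {x xs} → x ∈ xs → P x → ¬ Q x → length (filter Q? xs) < length (filter P? xs)
  length-filter-strict {xs = x ∷ xs} (here refl) px ¬qx with Q? x | P? x
  ... | yes q | _     = contradiction q ¬qx
  ... | no _  | yes _ = s≤s (length-filter-mono xs)
  ... | no _  | no ¬p = contradiction px ¬p
  length-filter-strict {xs = y ∷ xs} (there x∈) px ¬qx with Q? y | P? y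
  ... | yes q | yes p = s≤s (length-filter-strict x∈ px ¬qx)
  ... | yes q | no ¬p = contradiction (Q⇒P q) ¬p
  ... | no ¬q | yes p = m≤n⇒m≤1+n (length-filter-strict x∈ px ¬qx)
  ... | no ¬q | no ¬p = length-filter-strict x∈ px ¬qx

length-cartesianProduct : ∀ {A B : Set} (xs : List A) (ys : List B) →
  length (cartesianProduct xs ys) ≡ length xs * length ys
length-cartesianProduct []       ys = refl
length-cartesianProduct (x ∷ xs) ys = trans (List.length-++ (map (x ,_) ys))
  (cong₂ _+_ (List.length-map (x ,_) ys) (length-cartesianProduct xs ys))

-- Arcs between vertices as literals.

module _ {n : ℕ} where

  private
    V = Fin n
    L = Lit (GVar n)
    C = Clause (GVar n)

  infix 9 _⟶_

  opaque
    -- The literal which is falsified by deciding that i precedes j.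
    _⟶_ : V → V → L
    i ⟶ j = x j i

    -- The sign tells whether the head is the smaller end, so an arc can be read off its literal
    -- even when its ends coincide. From here on literals are told apart by their vertices alone.
    ⟶-injective : ∀ {i j k l} → i ⟶ j ≡ k ⟶ l → i ≡ k × j ≡ l
    ⟶-injective {i} {j} {k} {l} eq with toℕ j <ᵇ toℕ i | toℕ l <ᵇ toℕ k
    ⟶-injective refl | true  | true  = refl , refl
    ⟶-injective refl | false | false = refl , refl

    compl-⟶ : ∀ {i j} → i ≢ j → compl (i ⟶ j) ≡ j ⟶ i
    compl-⟶ {i} {j} i≢j with toℕ j <ᵇ toℕ i in eq | toℕ i <ᵇ toℕ j in eq′
    ... | true  | false = refl
    ... | false | true  = refl
    ... | true  | true  = contradiction (<ᵇ⇒< (toℕ i) (toℕ j) (subst T (sym eq′) tt))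
                                        (<-asym (<ᵇ⇒< (toℕ j) (toℕ i) (subst T (sym eq) tt)))
    ... | false | false = contradiction (toℕ-injective (≤-antisym (≮⇒≥ (subst T eq ∘ <⇒<ᵇ)) (≮⇒≥ (subst T eq′ ∘ <⇒<ᵇ)))) i≢j

    ⟶-x : ∀ {i j} → x j i ≡ i ⟶ j
    ⟶-x = refl

    ∈-Wide⁺ : ∀ {i j} → i ≢ j → i ⟶ j ∈ Wide i
    ∈-Wide⁺ {i} {j} i≢j = ∈-concatMap⁺ _ (lose (∈-allFin j) member)
      where
      member : i ⟶ j ∈ (if does (j ≟ i) then [] else [ x j i ])
      member with j ≟ i
      ... | yes j≡i = contradiction (sym j≡i) i≢j
      ... | no  _   = here refl

    ∈-Wide⁻ : ∀ {i l} → l ∈ Wide i → ∃[ j ] (i ≢ j × l ≡ i ⟶ j)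
    ∈-Wide⁻ {i} {l} l∈ with find (∈-concatMap⁻ _ {xs = allFin n} l∈)
    ... | j , _ , l∈j = go l∈j
      where
      go : l ∈ (if does (j ≟ i) then [] else [ x j i ]) → ∃[ j ] (i ≢ j × l ≡ i ⟶ j)
      go l∈j with j ≟ i
      go (here eq) | no j≢i = j , j≢i ∘ sym , eq

  x̄-⟶ : ∀ {i j} → i ≢ j → x̄ i j ≡ i ⟶ j
  x̄-⟶ i≢j = trans (cong compl ⟶-x) (compl-⟶ (i≢j ∘ sym))

  ⟶-var : ∀ {i j} → i ≢ j → proj₁ (j ⟶ i) ≡ proj₁ (i ⟶ j)
  ⟶-var i≢j = sym (cong proj₁ (compl-⟶ i≢j))

  ⟶-≢ˡ : ∀ {i j k l} → i ≢ k → i ⟶ j ≢ k ⟶ l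
  ⟶-≢ˡ i≢k = i≢k ∘ proj₁ ∘ ⟶-injective

  ⟶-≢ʳ : ∀ {i j k l} → j ≢ l → i ⟶ j ≢ k ⟶ l
  ⟶-≢ʳ j≢l = j≢l ∘ proj₂ ∘ ⟶-injective

  _≟ₗ_ : DecidableEquality L
  _≟ₗ_ = Product.≡-dec (Product.≡-dec _≟_ _≟_) Bool._≟_

  _≟ᶜ_ : DecidableEquality C
  _≟ᶜ_ = List.≡-dec _≟ₗ_

  open DecMembership (_≟_ {n}) using () renaming (_∈?_ to _∈ᵥ?_)
  open DecMembership _≟ₗ_ using (_∈?_)
  open DecMembership _≟ᶜ_ using () renaming (_∈?_ to _∈ᶜ?_)

  -- Resolution, on a literal and its complement

  remove : L → C → C
  remove l = filter (λ l′ → ¬? (l′ ≟ₗ l))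

  ∈-remove⁺ : ∀ {l l′ D} → l′ ∈ D → l′ ≢ l → l′ ∈ remove l D
  ∈-remove⁺ = ∈-filter⁺ _

  ∈-remove⁻ : ∀ {l l′} D → l′ ∈ remove l D → l′ ∈ D × l′ ≢ l
  ∈-remove⁻ D = ∈-filter⁻ _ {xs = D}

  remove-⊆ : ∀ l D → remove l D ⊆ D
  remove-⊆ l D = proj₁ ∘ ∈-remove⁻ D

  ≈-remove : ∀ {l D} → l ∈ D → D ≈ (l ∷ remove l D)
  ≈-remove {l} {D} l∈D = mk⇔ to from
    where
    to : ∀ {l′} → l′ ∈ D → l′ ∈ l ∷ remove l D
    to {l′} l′∈ with l′ ≟ₗ l
    ... | yes l′≡l = here l′≡l
    ... | no  l′≢l = there (∈-remove⁺ l′∈ l′≢l)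
    from : ∀ {l′} → l′ ∈ l ∷ remove l D → l′ ∈ D
    from (here refl) = l∈D
    from (there l′∈) = remove-⊆ l D l′∈

  ++-≈-comm : ∀ (A B : C) → (A ++ B) ≈ (B ++ A)
  ++-≈-comm A B = mk⇔ (swap A B) (swap B A)
    where
    swap : ∀ A B {l : L} → l ∈ A ++ B → l ∈ B ++ A
    swap A B = [ ∈-++⁺ʳ B , ∈-++⁺ˡ ]′ ∘ ∈-++⁻ A

  resolvent : L → C → C → C
  resolvent l A B = remove l A ++ remove (compl l) B

  ≈-refl : ∀ {A : C} → A ≈ A
  ≈-refl = mk⇔ id id

  -- `Resolves` expects the clause with the positive literal first, so the sign of `l` decides which
  -- alternative holds. `PoolValid` accepts both.
  resolvent-resolves : ∀ l {A B} → l ∈ A → compl l ∈ B → compl l ∉ A → l ∉ B →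
    Resolves (proj₁ l) A B (resolvent l A B) ⊎ Resolves (proj₁ l) B A (resolvent l A B)
  resolvent-resolves (v , true) {A} {B} l∈A l̄∈B l̄∉A l∉B =
    inj₁ (remove _ A , remove _ B , ≈-remove l∈A , ≈-remove l̄∈B ,
          l̄∉A ∘ remove-⊆ _ A , l∉B ∘ remove-⊆ _ B , ≈-refl)
  resolvent-resolves (v , false) {A} {B} l∈A l̄∈B l̄∉A l∉B =
    inj₂ (remove _ B , remove _ A , ≈-remove l̄∈B , ≈-remove l∈A ,
          l∉B ∘ remove-⊆ _ B , l̄∉A ∘ remove-⊆ _ A , ++-≈-comm (remove _ A) _)

  Fresh : C → V → V → Set
  Fresh Γ a b = a ⟶ b ∉ Γ × b ⟶ a ∉ Γ

  fresh? : ∀ Γ a b → Dec (Fresh Γ a b)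
  fresh? Γ a b = ¬? (a ⟶ b ∈? Γ) ×-dec ¬? (b ⟶ a ∈? Γ)

  -- The two literals of this variable are `a ⟶ b` and `b ⟶ a`. If neither was falsified on the
  -- path, the variable was not resolved on there; regularity is always obtained in this way.
  fresh-var : ∀ {Γ a b} → a ≢ b → Fresh Γ a b → proj₁ (a ⟶ b) ∉ map proj₁ Γ
  fresh-var {Γ} {a} {b} a≢b (ab∉Γ , ba∉Γ) v∈ with ∈-map⁻ proj₁ v∈
  ... | (v , c) , l∈Γ , refl with c Bool.≟ proj₂ (a ⟶ b)
  ...   | yes refl = ab∉Γ l∈Γ
  ...   | no  c≢   = ba∉Γ (subst (_∈ Γ) (trans (cong (v ,_) (Bool.¬-not c≢)) (compl-⟶ a≢b)) l∈Γ)

  ∈-resolvent⁻ : ∀ {a b} → a ≢ b → ∀ A B {l} → l ∈ resolvent (a ⟶ b) A B →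
    (l ∈ A × l ≢ a ⟶ b) ⊎ (l ∈ B × l ≢ b ⟶ a)
  ∈-resolvent⁻ {a} {b} a≢b A B l∈ with ∈-++⁻ (remove (a ⟶ b) A) l∈
  ... | inj₁ l∈A = inj₁ (∈-remove⁻ A l∈A)
  ... | inj₂ l∈B with ∈-remove⁻ B l∈B
  ...   | l∈ , l≢ = inj₂ (l∈ , l≢ ∘ λ eq → trans eq (sym (compl-⟶ a≢b)))

  ∈-resolvent⁺ˡ : ∀ {p} A B {l} → l ∈ A → l ≢ p → l ∈ resolvent p A B
  ∈-resolvent⁺ˡ A B l∈ l≢ = ∈-++⁺ˡ (∈-remove⁺ l∈ l≢)

  ∈-resolvent⁺ʳ : ∀ {a b} → a ≢ b → ∀ A B {l} → l ∈ B → l ≢ b ⟶ a → l ∈ resolvent (a ⟶ b) A B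
  ∈-resolvent⁺ʳ a≢b A B l∈ l≢ = ∈-++⁺ʳ (remove _ A) (∈-remove⁺ l∈ (l≢ ∘ λ eq → trans eq (compl-⟶ a≢b)))

  -- F is refuted, P lists the clauses derived before, and Γ is falsified by the decisions
  -- made on the way from the root.
  record Derivation (F : C → Set) (P : List C) (Γ : C) : Set where
    constructor mk
    field
      tree       : Tree (GVar n)
      conclusion : C
      concludes  : label tree ≡ conclusion
      valid      : PoolValid F P tree
      regular    : Regular (map proj₁ Γ) tree

  open Derivation public

  Usable : (C → Set) → List C → C → Set
  Usable F P D = F D ⊎ D ∈ P

  -- Assembling derivations along a path of decisions.

  module _ {F : C → Set} where

    assume : ∀ {P Γ D} → Usable F P D → Derivation F P Γ
    assume {D = D} u = mk (leaf D) D refl (Sum.map (λ f → D , f , ≈-refl) (λ D∈P → lose D∈P ≈-refl) u) tt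

    -- The second subtree may use every clause of the first as a lemma. The membership conditions on
    -- the two conclusions are those of a proper resolution inference.
    branch : ∀ {P Γ a b} → a ≢ b → Fresh Γ a b →
      (d : Derivation F P (a ⟶ b ∷ Γ)) → a ⟶ b ∈ conclusion d → b ⟶ a ∉ conclusion d →
      (d′ : Derivation F (P ++ postorder (tree d)) (b ⟶ a ∷ Γ)) → b ⟶ a ∈ conclusion d′ → a ⟶ b ∉ conclusion d′ →
      Derivation F P Γ
    branch {Γ = Γ} {a} {b} a≢b fresh d ab∈d ba∉d d′ ba∈d′ ab∉d′ = mk
      (node D (proj₁ (a ⟶ b)) (tree d) (tree d′)) D refl
      (valid d , valid d′ ,
       subst₂ (λ A B → Resolves _ A B D ⊎ Resolves _ B A D) (sym (concludes d)) (sym (concludes d′))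
         (resolvent-resolves (a ⟶ b) ab∈d (subst (_∈ _) (sym eq) ba∈d′) (ba∉d ∘ subst (_∈ _) eq) ab∉d′))
      (fresh-var a≢b fresh , regular d ,
       subst (λ v → Regular (v ∷ map proj₁ Γ) (tree d′)) (⟶-var a≢b) (regular d′))
      where
      eq = compl-⟶ a≢b
      D = resolvent (a ⟶ b) (conclusion d) (conclusion d′)

    -- Making u precede all of Z: each query u ⟶ z is answered negatively by a small derivation, and
    -- U describes the literals which may remain.
    absorb : ∀ {P Γ} u (U : L → Set) Z → Unique Z →
      (∀ {z} → z ∈ Z → u ≢ z × Fresh Γ u z × ¬ U (u ⟶ z) × ¬ U (z ⟶ u)) →
      (∀ {z Z′ P′} → z ∈ Z → P ⊆ P′ → Σ (Derivation F P′ (z ⟶ u ∷ map (u ⟶_) Z′ ++ Γ)) λ d →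
         z ⟶ u ∈ conclusion d ×
         (∀ {l} → l ∈ conclusion d → l ≡ z ⟶ u ⊎ U l ⊎ l ∈ map (u ⟶_) Z′) ×
         size (tree d) ≤ 3) →
      (d : Derivation F P (map (u ⟶_) Z ++ Γ)) →
      (∀ {z} → z ∈ Z → u ⟶ z ∈ conclusion d) →
      (∀ {l} → l ∈ conclusion d → U l ⊎ l ∈ map (u ⟶_) Z) →
      Σ (Derivation F P Γ) λ d′ →
        (∀ {l} → l ∈ conclusion d′ → U l) ×
        (∀ {l} → U l → l ∈ conclusion d → l ∈ conclusion d′) ×
        size (tree d′) ≤ size (tree d) + 4 * length Z ×
        postorder (tree d) ⊆ postorder (tree d′)
    absorb u U [] _ _ _ d _ upper =
      d , ([ id , (λ ()) ]′ ∘ upper) , (λ _ → id) , m≤m+n _ _ , id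
    absorb {P} {Γ} u U (z ∷ Z) (z∉Z ∷ unique) sep close d lower upper
      with close {Z′ = Z} (here refl) (xs⊆xs++ys P (postorder (tree d)))
    ... | e , zu∈e , e-upper , e-size
      with absorb u U Z unique (sep ∘ there) (close ∘ there) d₁ d₁-lower d₁-upper
      where
      u≢z = proj₁ (sep (here refl))
      uz∉U = proj₁ (proj₂ (proj₂ (sep (here refl))))
      zu∉U = proj₂ (proj₂ (proj₂ (sep (here refl))))

      uz∉Z : u ⟶ z ∉ map (u ⟶_) Z
      uz∉Z uz∈ with ∈-map⁻ (u ⟶_) uz∈
      ... | z′ , z′∈Z , eq = All.lookup z∉Z z′∈Z (proj₂ (⟶-injective eq))

      zu∉Z : z ⟶ u ∉ map (u ⟶_) Z
      zu∉Z zu∈ with ∈-map⁻ (u ⟶_) zu∈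
      ... | z′ , _ , eq = u≢z (sym (proj₁ (⟶-injective eq)))

      fresh : Fresh (map (u ⟶_) Z ++ Γ) u z
      fresh with proj₁ (proj₂ (sep (here refl)))
      ... | uz∉Γ , zu∉Γ = [ uz∉Z , uz∉Γ ]′ ∘ ∈-++⁻ _ , [ zu∉Z , zu∉Γ ]′ ∘ ∈-++⁻ _

      zu∉d : z ⟶ u ∉ conclusion d
      zu∉d zu∈d with upper zu∈d
      ... | inj₁ zu∈U         = zu∉U zu∈U
      ... | inj₂ (here eq)    = u≢z (sym (proj₁ (⟶-injective eq)))
      ... | inj₂ (there zu∈Z) = zu∉Z zu∈Z

      uz∉e : u ⟶ z ∉ conclusion e
      uz∉e uz∈e with e-upper uz∈e
      ... | inj₁ eq          = u≢z (proj₁ (⟶-injective eq))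
      ... | inj₂ (inj₁ uz∈U) = uz∉U uz∈U
      ... | inj₂ (inj₂ uz∈Z) = uz∉Z uz∈Z

      -- `z` is the latest decision on the path, so it is resolved away first, which leaves the same
      -- situation for `Z`.
      d₁ : Derivation F P (map (u ⟶_) Z ++ Γ)
      d₁ = branch u≢z fresh d (lower (here refl)) zu∉d e zu∈e uz∉e

      d₁-lower : ∀ {z′} → z′ ∈ Z → u ⟶ z′ ∈ conclusion d₁
      d₁-lower z′∈Z = ∈-resolvent⁺ˡ (conclusion d) (conclusion e) (lower (there z′∈Z))
        (⟶-≢ʳ (All.lookup z∉Z z′∈Z ∘ sym))

      d₁-upper : ∀ {l} → l ∈ conclusion d₁ → U l ⊎ l ∈ map (u ⟶_) Z
      d₁-upper l∈ with ∈-resolvent⁻ u≢z (conclusion d) (conclusion e) l∈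
      ... | inj₂ (l∈e , l≢zu) = [ (λ l≡ → contradiction l≡ l≢zu) , id ]′ (e-upper l∈e)
      ... | inj₁ (l∈d , l≢uz) with upper l∈d
      ...   | inj₁ l∈U         = inj₁ l∈U
      ...   | inj₂ (here l≡uz) = contradiction l≡uz l≢uz
      ...   | inj₂ (there l∈Z) = inj₂ l∈Z
    ... | d′ , d′-upper , d′-keeps , d′-size , d₁⊆d′ =
      d′ , d′-upper , keeps , bound , d₁⊆d′ ∘ ∈-++⁺ˡ
      where
      keeps : ∀ {l} → U l → l ∈ conclusion d → l ∈ conclusion d′
      keeps l∈U l∈d = d′-keeps l∈U (∈-resolvent⁺ˡ (conclusion d) (conclusion e) l∈d
        λ { refl → proj₁ (proj₂ (proj₂ (sep (here refl)))) l∈U })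

      arith : ∀ a k → a + 3 + 1 + 4 * k ≡ a + 4 * suc k
      arith = solve-∀

      -- Each element of `Z` costs at most three nodes for its negative answer and one for the
      -- resolution.
      bound : size (tree d′) ≤ size (tree d) + 4 * suc (length Z)
      bound = begin
        size (tree d′)                                      ≤⟨ d′-size ⟩
        size (tree d) + size (tree e) + 1 + 4 * length Z    ≤⟨ +-monoˡ-≤ _ (+-monoˡ-≤ 1 (+-monoʳ-≤ (size (tree d)) e-size)) ⟩
        size (tree d) + 3 + 1 + 4 * length Z                ≡⟨ arith (size (tree d)) (length Z) ⟩
        size (tree d) + 4 * suc (length Z)                  ∎
        where open ≤-Reasoning

  -- Guarded transitivity clauses.

  module Guarded (r s : Guard n) (guards : GuardConditions n r s) where

    private
      Proof = Derivation (GGT n r s)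

    △ : V → V → V → C
    △ w z u = w ⟶ z ∷ z ⟶ u ∷ u ⟶ w ∷ []

    Tr-△ : ∀ {w z u} → Distinct w z u → Tr w z u ≡ △ w z u
    Tr-△ (w≢z , z≢u , w≢u) =
      cong₂ _∷_ (x̄-⟶ w≢z) (cong₂ _∷_ (x̄-⟶ z≢u) (cong (_∷ []) (x̄-⟶ (w≢u ∘ sym))))

    module _ {w z u : V} (distinct : Distinct w z u) where

      private
        R = r w z u
        S = s w z u

      r≢s : R ≢ S
      r≢s = proj₁ (guards w z u distinct)

      △-ends : ∀ {a b} → a ⟶ b ∈ △ w z u → In3 a w z u × In3 b w z u
      △-ends (here eq)                 with ⟶-injective eq
      ... | refl , refl = inj₁ refl , inj₂ (inj₁ refl)
      △-ends (there (here eq))         with ⟶-injective eq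
      ... | refl , refl = inj₂ (inj₁ refl) , inj₂ (inj₂ refl)
      △-ends (there (there (here eq))) with ⟶-injective eq
      ... | refl , refl = inj₂ (inj₂ refl) , inj₁ refl

      -- Both ends of every literal of the triangle lie among `w`, `z`, `u`, but those of the guard
      -- do not. Hence resolving on the guard leaves the triangle intact.
      rs∉△ : R ⟶ S ∉ △ w z u
      rs∉△ = proj₁ (proj₂ (guards w z u distinct)) ∘ △-ends

      sr∉△ : S ⟶ R ∉ △ w z u
      sr∉△ sr∈ with △-ends sr∈
      ... | s∈ , r∈ = proj₁ (proj₂ (guards w z u distinct)) (r∈ , s∈)

      sr≢rs : S ⟶ R ≢ R ⟶ S
      sr≢rs = ⟶-≢ˡ (r≢s ∘ sym)

      GGT-sr : GGT n r s (△ w z u ++ [ S ⟶ R ])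
      GGT-sr = inj₂ (w , z , u , distinct , inj₁ (cong₂ (λ D l → D ++ [ l ]) (sym (Tr-△ distinct)) (sym ⟶-x)))

      GGT-rs : GGT n r s (△ w z u ++ [ R ⟶ S ])
      GGT-rs = inj₂ (w , z , u , distinct ,
        inj₂ (cong₂ (λ D l → D ++ [ l ]) (sym (Tr-△ distinct)) (sym (x̄-⟶ r≢s))))

    -- As a set this is `△ w z u` (for distinct vertices). It is kept as the very list that `learn`
    -- concludes, because `P` is searched up to equality of lists.
    learned : V → V → V → C
    learned w z u =
      resolvent (r w z u ⟶ s w z u) (△ w z u ++ [ r w z u ⟶ s w z u ]) (△ w z u ++ [ s w z u ⟶ r w z u ])

    △⊆learned : ∀ {w z u} → Distinct w z u → △ w z u ⊆ learned w z u
    △⊆learned {w} {z} {u} distinct l∈△ =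
      ∈-resolvent⁺ˡ (△ w z u ++ [ _ ]) (△ w z u ++ [ _ ]) (∈-++⁺ˡ l∈△) (λ { refl → rs∉△ distinct l∈△ })

    learned⊆△ : ∀ {w z u} → Distinct w z u → learned w z u ⊆ △ w z u
    learned⊆△ {w} {z} {u} distinct l∈
      with ∈-resolvent⁻ (r≢s distinct) (△ w z u ++ [ _ ]) (△ w z u ++ [ _ ]) l∈
    ... | inj₁ (l∈ , l≢) = [ id , (λ { (here eq) → contradiction eq l≢ }) ]′ (∈-++⁻ (△ w z u) l∈)
    ... | inj₂ (l∈ , l≢) = [ id , (λ { (here eq) → contradiction eq l≢ }) ]′ (∈-++⁻ (△ w z u) l∈)

    learn : ∀ {P Γ w z u} → Distinct w z u → Fresh Γ (r w z u) (s w z u) → Proof P Γ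
    learn {w = w} {z} {u} distinct fresh = branch (r≢s distinct) fresh
      (assume (inj₁ (GGT-rs distinct))) (∈-++⁺ʳ (△ w z u) (here refl))
      ([ sr∉△ distinct , (λ { (here eq) → sr≢rs distinct eq }) ]′ ∘ ∈-++⁻ (△ w z u))
      (assume (inj₁ (GGT-sr distinct))) (∈-++⁺ʳ (△ w z u) (here refl))
      ([ rs∉△ distinct , (λ { (here eq) → sr≢rs distinct (sym eq) }) ]′ ∘ ∈-++⁻ (△ w z u))

    Available : List C → C → V → V → V → Set
    Available P Γ w z u = ∃[ D ] Usable (GGT n r s) P D × △ w z u ⊆ D × (∀ {l} → l ∈ D → l ∈ △ w z u ⊎ l ∈ Γ)

    -- If the guard is decided, one of the two guarded clauses has its guard literal in `Γ` and
    -- serves as it stands, without resolving on the guard again.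
    available : ∀ {P Γ w z u} → Distinct w z u →
      learned w z u ∈ P ⊎ ¬ Fresh Γ (r w z u) (s w z u) → Available P Γ w z u
    available {w = w} {z} {u} distinct (inj₁ learned∈P) =
      learned w z u , inj₂ learned∈P , △⊆learned distinct , inj₁ ∘ learned⊆△ distinct
    available {Γ = Γ} {w} {z} {u} distinct (inj₂ ¬fresh) with r w z u ⟶ s w z u ∈? Γ | s w z u ⟶ r w z u ∈? Γ
    ... | yes rs∈Γ | _ = △ w z u ++ [ _ ] , inj₁ (GGT-rs distinct) , ∈-++⁺ˡ ,
      Sum.map id (λ { (here eq) → subst (_∈ Γ) (sym eq) rs∈Γ }) ∘ ∈-++⁻ (△ w z u)
    ... | no _ | yes sr∈Γ = △ w z u ++ [ _ ] , inj₁ (GGT-sr distinct) , ∈-++⁺ˡ ,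
      Sum.map id (λ { (here eq) → subst (_∈ Γ) (sym eq) sr∈Γ }) ∘ ∈-++⁻ (△ w z u)
    ... | no rs∉Γ | no sr∉Γ = contradiction (rs∉Γ , sr∉Γ) ¬fresh

    -- This works on every path: a single leaf if the guard is decided, and otherwise the three
    -- nodes of `learn`.
    derive-△ : ∀ P Γ {w z u} → Distinct w z u → Σ (Proof P Γ) λ d →
      △ w z u ⊆ conclusion d × (∀ {l} → l ∈ conclusion d → l ∈ △ w z u ⊎ l ∈ Γ) × size (tree d) ≤ 3
    derive-△ P Γ {w} {z} {u} distinct with fresh? Γ (r w z u) (s w z u)
    ... | no ¬fresh with available {P} distinct (inj₂ ¬fresh)
    ...   | D , usable , lower , upper = assume usable , lower , upper , s≤s z≤n
    derive-△ P Γ {w} {z} {u} distinct | yes fresh =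
      learn distinct fresh , △⊆learned distinct , inj₁ ∘ learned⊆△ distinct , ≤-refl

    -- States of the search, and the clauses needed below them.

    record State (Γ : C) : Set₁ where
      field
        Root        : V → Set
        root?       : Decidable Root
        target      : ∀ {i j} → i ⟶ j ∈ Γ → ¬ Root j
        parent      : V → V
        parent-root : ∀ {y} → ¬ Root y → Root (parent y)
        parent-edge : ∀ {y} → ¬ Root y → parent y ⟶ y ∈ Γ

      -- The transitivity clauses which the ordering refutation below this state uses.
      record Needed (w z u : V) : Set where
        pattern
        constructor needed
        field
          w-root : Root w
          u-root : Root u
          w≢u    : w ≢ u
          cases  : (Root z × z ≢ w × z ≢ u) ⊎ (¬ Root z × parent z ≡ w × u ⟶ z ∉ Γ)

      distinct : ∀ {w z u} → Needed w z u → Distinct w z u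
      distinct (needed wr ur w≢u (inj₁ (zr , z≢w , z≢u))) = z≢w ∘ sym , z≢u , w≢u
      distinct (needed wr ur w≢u (inj₂ (¬zr , _ , _)))     =
        (λ { refl → ¬zr wr }) , (λ { refl → ¬zr ur }) , w≢u

      needed? : ∀ w z u → Dec (Needed w z u)
      needed? w z u with root? w ×-dec root? u ×-dec ¬? (w ≟ u) ×-dec
        ((root? z ×-dec ¬? (z ≟ w) ×-dec ¬? (z ≟ u)) ⊎-dec (¬? (root? z) ×-dec (parent z ≟ w) ×-dec ¬? (u ⟶ z ∈? Γ)))
      ... | yes (wr , ur , w≢u , c) = yes (needed wr ur w≢u c)
      ... | no ¬p = no λ { (needed wr ur w≢u c) → ¬p (wr , ur , w≢u , c) }

    length-candidates : ∀ {Q : V → Set} (Q? : Decidable Q) → length (filter Q? (allFin n)) ≤ n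
    length-candidates Q? = ≤-trans (List.length-filter Q? (allFin n)) (≤-reflexive (List.length-tabulate id))

    label∈postorder : ∀ (t : Tree (GVar n)) → label t ∈ postorder t
    label∈postorder (leaf D)       = here refl
    label∈postorder (node D v t u) = ∈-++⁺ʳ (postorder t) (∈-++⁺ʳ (postorder u) (here refl))

    conclusion∈postorder : ∀ {P Γ} (d : Proof P Γ) → conclusion d ∈ postorder (tree d)
    conclusion∈postorder d = subst (_∈ postorder (tree d)) (concludes d) (label∈postorder (tree d))

    -- The ordering refutation over the roots.

    module Base {Γ₀ : C} (σ : State Γ₀) {P₀ : List C}
      (ready : ∀ {w z u} → State.Needed σ w z u → Available P₀ Γ₀ w z u) where

      open State σ

      -- Q lists the roots which have not been compared yet, so D says that c does not precede
      -- all the others.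
      record Star (c : V) (Q : List V) (D : C) : Set where
        field
          roots : ∀ {j} → Root j → c ≢ j → j ∉ Q → c ⟶ j ∈ D
          given : ∀ {y} → c ⟶ y ∈ Γ₀ → c ⟶ y ∈ D
          upper : ∀ {l} → l ∈ D → l ∈ Γ₀ ⊎ ∃[ j ] Root j × c ≢ j × j ∉ Q × l ≡ c ⟶ j

      -- This guarantees that all later queries are fresh: comparisons with pending roots, and arcs
      -- from roots to leaves that `Γ₀` leaves open. Decisions between roots outside `Q` preserve
      -- it.
      record Clean (Γ : C) (Q : List V) : Set where
        field
          roots  : ∀ {i k} → Root i → k ∈ Q → i ≢ k → Fresh Γ i k
          leaves : ∀ {c y} → Root c → ¬ Root y → c ⟶ y ∉ Γ₀ → Fresh Γ c y

      clean-∷ : ∀ {a b Γ Q} → Root a → Root b → a ∉ Q → b ∉ Q → Clean Γ Q → Clean (a ⟶ b ∷ Γ) Q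
      clean-∷ {a} {b} ra rb a∉Q b∉Q clean = record
        { roots  = λ { {i} {k} ri k∈Q i≢k → let ik , ki = Clean.roots clean ri k∈Q i≢k in
            (λ { (here eq) → b∉Q (subst (_∈ _) (proj₂ (⟶-injective eq)) k∈Q) ; (there ik∈) → ik ik∈ }) ,
            (λ { (here eq) → a∉Q (subst (_∈ _) (proj₁ (⟶-injective eq)) k∈Q) ; (there ki∈) → ki ki∈ }) }
        ; leaves = λ { {c} {y} rc ¬ry cy∉ → let cy , yc = Clean.leaves clean rc ¬ry cy∉ in
            (λ { (here eq) → ¬ry (subst Root (sym (proj₂ (⟶-injective eq))) rb) ; (there cy∈) → cy cy∈ }) ,
            (λ { (here eq) → ¬ry (subst Root (sym (proj₁ (⟶-injective eq))) ra) ; (there yc∈) → yc yc∈ }) }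
        }

      clean-map : ∀ {k Γ Q} Z → Root k → k ∉ Q → (∀ {z} → z ∈ Z → Root z × z ∉ Q) → Clean Γ Q →
        Clean (map (k ⟶_) Z ++ Γ) Q
      clean-map []      rk k∉Q rZ clean = clean
      clean-map (z ∷ Z) rk k∉Q rZ clean =
        clean-∷ rk (proj₁ (rZ (here refl))) k∉Q (proj₂ (rZ (here refl))) (clean-map Z rk k∉Q (rZ ∘ there) clean)

      clean-tail : ∀ {k Γ Q} → Clean Γ (k ∷ Q) → Clean Γ Q
      clean-tail clean = record { roots = λ ri k∈Q → Clean.roots clean ri (there k∈Q) ; leaves = Clean.leaves clean }

      module _ (c : V) where

        unsettled? : Decidable (λ y → ¬ Root y × c ⟶ y ∉ Γ₀)
        unsettled? y = ¬? (root? y) ×-dec ¬? (c ⟶ y ∈? Γ₀)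

        unsettled : List V
        unsettled = filter unsettled? (allFin n)

      -- With no root pending, the wide clause of `c` is the star except for leaves `z` not yet
      -- known to follow `c`. Each is absorbed through the triangle of `parent z`, `z`, `c`, which
      -- adds only the literals `parent z ⟶ z` of `Γ₀` and `c ⟶ parent z` of the star.
      finish : ∀ {P Γ c} → P₀ ⊆ P → Root c → Clean Γ [] →
        Σ (Proof P Γ) λ d → Star c [] (conclusion d) × size (tree d) ≤ 1 + 4 * n
      finish {P} {Γ} {c} P₀⊆P rc clean
        with absorb {P = P} {Γ} c U (unsettled c) (filter⁺ (unsettled? c) (allFin⁺ n)) separate close
               (assume (inj₁ (inj₁ (c , refl)))) (λ z∈Z → ∈-Wide⁺ (proj₁ (separate z∈Z))) wide
        where
        U : L → Set
        U l = l ∈ Γ₀ ⊎ ∃[ j ] Root j × c ≢ j × j ∉ [] × l ≡ c ⟶ j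

        spec : ∀ {z} → z ∈ unsettled c → ¬ Root z × c ⟶ z ∉ Γ₀
        spec = proj₂ ∘ ∈-filter⁻ (unsettled? c) {xs = allFin n}

        separate : ∀ {z} → z ∈ unsettled c → c ≢ z × Fresh Γ c z × ¬ U (c ⟶ z) × ¬ U (z ⟶ c)
        separate {z} z∈Z with spec z∈Z
        ... | ¬rz , cz∉ =
          (λ { refl → ¬rz rc }) , Clean.leaves clean rc ¬rz cz∉ ,
          (λ { (inj₁ cz∈) → cz∉ cz∈
             ; (inj₂ (j , rj , _ , _ , eq)) → ¬rz (subst Root (sym (proj₂ (⟶-injective eq))) rj) }) ,
          (λ { (inj₁ zc∈) → target zc∈ rc
             ; (inj₂ (j , _ , _ , _ , eq)) → ¬rz (subst Root (sym (proj₁ (⟶-injective eq))) rc) })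

        close : ∀ {z Z′ P′} → z ∈ unsettled c → P ⊆ P′ → Σ (Proof P′ (z ⟶ c ∷ map (c ⟶_) Z′ ++ Γ)) λ d →
          z ⟶ c ∈ conclusion d ×
          (∀ {l} → l ∈ conclusion d → l ≡ z ⟶ c ⊎ U l ⊎ l ∈ map (c ⟶_) Z′) × size (tree d) ≤ 3
        close {z} z∈Z P⊆P′ with spec z∈Z
        -- `c` is not the parent of `z`, because the arc from the parent belongs to `Γ₀`.
        ... | ¬rz , cz∉ with ready (needed (parent-root ¬rz) rc (λ { refl → cz∉ (parent-edge ¬rz) }) (inj₂ (¬rz , refl , cz∉)))
        ...   | D , usable , △⊆D , D⊆ =
          assume (Sum.map id (P⊆P′ ∘ P₀⊆P) usable) , △⊆D (there (here refl)) , bounded ∘ D⊆ , s≤s z≤n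
          where
          bounded : ∀ {l} → l ∈ △ (parent z) z c ⊎ l ∈ Γ₀ → l ≡ z ⟶ c ⊎ U l ⊎ l ∈ _
          bounded (inj₁ (here refl))                 = inj₂ (inj₁ (inj₁ (parent-edge ¬rz)))
          bounded (inj₁ (there (here eq)))           = inj₁ eq
          bounded (inj₁ (there (there (here eq))))   =
            inj₂ (inj₁ (inj₂ (parent z , parent-root ¬rz , (λ { refl → cz∉ (parent-edge ¬rz) }) , (λ ()) , eq)))
          bounded (inj₂ l∈Γ₀)                        = inj₂ (inj₁ (inj₁ l∈Γ₀))

        wide : ∀ {l} → l ∈ Wide c → U l ⊎ l ∈ map (c ⟶_) (unsettled c)
        wide l∈ with ∈-Wide⁻ l∈
        ... | j , c≢j , refl with root? j | c ⟶ j ∈? Γ₀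
        ...   | yes rj | _       = inj₁ (inj₂ (j , rj , c≢j , (λ ()) , refl))
        ...   | no _   | yes cj∈ = inj₁ (inj₁ cj∈)
        ...   | no ¬rj | no cj∉  = inj₂ (∈-map⁺ (c ⟶_) (∈-filter⁺ (unsettled? c) (∈-allFin j) (¬rj , cj∉)))
      ... | d , upper , keeps , bound , _ = d , star , ≤-trans bound (s≤s (*-monoʳ-≤ 4 (length-candidates (unsettled? c))))
        where
        star : Star c [] (conclusion d)
        star = record
          { roots = λ rj c≢j j∉ → keeps (inj₂ (_ , rj , c≢j , j∉ , refl)) (∈-Wide⁺ c≢j)
          ; given = λ cy∈ → keeps (inj₁ cy∈) (∈-Wide⁺ λ { refl → target cy∈ rc })
          ; upper = upper
          }

      module _ (c k : V) (Q : List V) where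

        compared? : Decidable (λ j → Root j × c ≢ j × k ≢ j × j ∉ Q)
        compared? j = root? j ×-dec ¬? (c ≟ j) ×-dec ¬? (k ≟ j) ×-dec ¬? (j ∈ᵥ? Q)

        compared : List V
        compared = filter compared? (allFin n)

        compared-spec : ∀ {j} → j ∈ compared → Root j × c ≢ j × k ≢ j × j ∉ Q
        compared-spec = proj₂ ∘ ∈-filter⁻ compared? {xs = allFin n}

      -- Either c precedes k, or k precedes c and hence everything that c precedes.
      extend : ∀ {P Γ c k Q} → P₀ ⊆ P → Root c → Root k → c ≢ k → c ∉ Q → k ∉ Q → Clean Γ (k ∷ Q) →
        (d : Proof P (c ⟶ k ∷ Γ)) → Star c Q (conclusion d) →
        (e : Proof (P ++ postorder (tree d)) (map (k ⟶_) (compared c k Q) ++ k ⟶ c ∷ Γ)) →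
        Star k Q (conclusion e) →
        Σ (Proof P Γ) λ f → Star c (k ∷ Q) (conclusion f) ×
          (∀ {l} → l ∈ Γ₀ → l ∈ conclusion d ⊎ l ∈ conclusion e → l ∈ conclusion f) ×
          size (tree f) ≤ size (tree d) + size (tree e) + (1 + 4 * n) ×
          postorder (tree d) ⊆ postorder (tree f) × postorder (tree e) ⊆ postorder (tree f)
      extend {P} {Γ} {c} {k} {Q} P₀⊆P rc rk c≢k c∉Q k∉Q clean d d-star e e-star
        with absorb k U (compared c k Q) (filter⁺ (compared? c k Q) (allFin⁺ n)) separate close e e-lower e-upper
        where
        U : L → Set
        U l = l ∈ Γ₀ ⊎ l ≡ k ⟶ c ⊎ ∃[ j ] Root j × c ≢ j × j ∉ k ∷ Q × l ≡ c ⟶ j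

        separate : ∀ {z} → z ∈ compared c k Q → k ≢ z × Fresh (k ⟶ c ∷ Γ) k z × ¬ U (k ⟶ z) × ¬ U (z ⟶ k)
        separate {z} z∈Z with compared-spec c k Q z∈Z | Clean.roots clean
        ... | rz , c≢z , k≢z , z∉Q | fresh =
          k≢z ,
          ((λ { (here eq) → c≢z (sym (proj₂ (⟶-injective eq))) ; (there kz∈) → proj₂ (fresh rz (here refl) (k≢z ∘ sym)) kz∈ }) ,
           (λ { (here eq) → k≢z (sym (proj₁ (⟶-injective eq))) ; (there zk∈) → proj₁ (fresh rz (here refl) (k≢z ∘ sym)) zk∈ })) ,
          (λ { (inj₁ kz∈) → target kz∈ rz
             ; (inj₂ (inj₁ eq)) → c≢z (sym (proj₂ (⟶-injective eq)))
             ; (inj₂ (inj₂ (_ , _ , _ , _ , eq))) → c≢k (sym (proj₁ (⟶-injective eq))) }) ,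
          (λ { (inj₁ zk∈) → target zk∈ rk
             ; (inj₂ (inj₁ eq)) → k≢z (sym (proj₁ (⟶-injective eq)))
             ; (inj₂ (inj₂ (_ , _ , _ , _ , eq))) → c≢z (sym (proj₁ (⟶-injective eq))) })

        close : ∀ {z Z′ P′} → z ∈ compared c k Q → P ++ postorder (tree d) ⊆ P′ →
          Σ (Proof P′ (z ⟶ k ∷ map (k ⟶_) Z′ ++ k ⟶ c ∷ Γ)) λ d →
          z ⟶ k ∈ conclusion d ×
          (∀ {l} → l ∈ conclusion d → l ≡ z ⟶ k ⊎ U l ⊎ l ∈ map (k ⟶_) Z′) × size (tree d) ≤ 3
        close {z} z∈Z P⊆P′ with compared-spec c k Q z∈Z
        -- The triangle of `c`, `z`, `k` trades `k ⟶ z` for `c ⟶ z`, which belongs to the star of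
        -- `c`, and `k ⟶ c`, which the final resolution removes.
        ... | rz , c≢z , k≢z , z∉Q with ready (needed rc rk c≢k (inj₁ (rz , c≢z ∘ sym , k≢z ∘ sym)))
        ...   | D , usable , △⊆D , D⊆ =
          assume (Sum.map id (P⊆P′ ∘ ∈-++⁺ˡ ∘ P₀⊆P) usable) , △⊆D (there (here refl)) , bounded ∘ D⊆ , s≤s z≤n
          where
          bounded : ∀ {l} → l ∈ △ c z k ⊎ l ∈ Γ₀ → l ≡ z ⟶ k ⊎ U l ⊎ l ∈ _
          bounded (inj₁ (here eq))                 =
            inj₂ (inj₁ (inj₂ (inj₂ (z , rz , c≢z , (λ { (here z≡k) → k≢z (sym z≡k) ; (there z∈Q) → z∉Q z∈Q }) , eq))))
          bounded (inj₁ (there (here eq)))         = inj₁ eq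
          bounded (inj₁ (there (there (here eq)))) = inj₂ (inj₁ (inj₂ (inj₁ eq)))
          bounded (inj₂ l∈Γ₀)                      = inj₂ (inj₁ (inj₁ l∈Γ₀))

        e-lower : ∀ {z} → z ∈ compared c k Q → k ⟶ z ∈ conclusion e
        e-lower z∈Z with compared-spec c k Q z∈Z
        ... | rz , _ , k≢z , z∉Q = Star.roots e-star rz k≢z z∉Q

        e-upper : ∀ {l} → l ∈ conclusion e → U l ⊎ l ∈ map (k ⟶_) (compared c k Q)
        e-upper l∈e with Star.upper e-star l∈e
        ... | inj₁ l∈Γ₀ = inj₁ (inj₁ l∈Γ₀)
        ... | inj₂ (j , rj , k≢j , j∉Q , eq) with c ≟ j
        ...   | yes refl = inj₁ (inj₂ (inj₁ eq))
        ...   | no  c≢j  = inj₂ (subst (_∈ _) (sym eq)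
                  (∈-map⁺ (k ⟶_) (∈-filter⁺ (compared? c k Q) (∈-allFin j) (rj , c≢j , k≢j , j∉Q))))
      ... | g , g-upper , g-keeps , g-size , e⊆g =
        f , star , keeps , bound , ∈-++⁺ˡ , ∈-++⁺ʳ (postorder (tree d)) ∘ ∈-++⁺ˡ ∘ e⊆g
        where
        U′ : L → Set
        U′ l = l ∈ Γ₀ ⊎ ∃[ j ] Root j × c ≢ j × j ∉ k ∷ Q × l ≡ c ⟶ j

        kc∉d : k ⟶ c ∉ conclusion d
        kc∉d kc∈ with Star.upper d-star kc∈
        ... | inj₁ kc∈Γ₀                  = target kc∈Γ₀ rc
        ... | inj₂ (_ , _ , _ , _ , eq)   = c≢k (sym (proj₁ (⟶-injective eq)))

        ck∉g : c ⟶ k ∉ conclusion g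
        ck∉g ck∈ with g-upper ck∈
        ... | inj₁ ck∈Γ₀                              = target ck∈Γ₀ rk
        ... | inj₂ (inj₁ eq)                          = c≢k (proj₁ (⟶-injective eq))
        ... | inj₂ (inj₂ (_ , _ , _ , j∉k∷Q , eq))    = j∉k∷Q (here (sym (proj₂ (⟶-injective eq))))

        f : Proof P Γ
        f = branch c≢k (Clean.roots clean rc (here refl) c≢k) d (Star.roots d-star rk c≢k k∉Q) kc∉d
              g (g-keeps (inj₂ (inj₁ refl)) (Star.roots e-star rc (c≢k ∘ sym) c∉Q)) ck∉g

        keeps : ∀ {l} → l ∈ Γ₀ → l ∈ conclusion d ⊎ l ∈ conclusion e → l ∈ conclusion f
        keeps l∈Γ₀ (inj₁ l∈d) = ∈-resolvent⁺ˡ (conclusion d) (conclusion g) l∈d (λ { refl → target l∈Γ₀ rk })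
        keeps l∈Γ₀ (inj₂ l∈e) = ∈-resolvent⁺ʳ c≢k (conclusion d) (conclusion g) (g-keeps (inj₁ l∈Γ₀) l∈e)
                                  (λ { refl → target l∈Γ₀ rc })

        upper : ∀ {l} → l ∈ conclusion f → U′ l
        upper l∈ with ∈-resolvent⁻ c≢k (conclusion d) (conclusion g) l∈
        ... | inj₁ (l∈d , l≢ck) with Star.upper d-star l∈d
        ...   | inj₁ l∈Γ₀ = inj₁ l∈Γ₀
        ...   | inj₂ (j , rj , c≢j , j∉Q , refl) =
          inj₂ (j , rj , c≢j , (λ { (here refl) → l≢ck refl ; (there j∈Q) → j∉Q j∈Q }) , refl)
        upper l∈ | inj₂ (l∈g , l≢kc) with g-upper l∈g
        ...   | inj₁ l∈Γ₀        = inj₁ l∈Γ₀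
        ...   | inj₂ (inj₁ l≡kc) = contradiction l≡kc l≢kc
        ...   | inj₂ (inj₂ cj)   = inj₂ cj

        star : Star c (k ∷ Q) (conclusion f)
        star = record
          { roots = λ rj c≢j j∉k∷Q → ∈-resolvent⁺ˡ (conclusion d) (conclusion g) (Star.roots d-star rj c≢j (j∉k∷Q ∘ there))
              (⟶-≢ʳ (j∉k∷Q ∘ here))
          ; given = λ cy∈ → keeps cy∈ (inj₁ (Star.given d-star cy∈))
          ; upper = upper
          }

        arith : ∀ a b m → a + (b + 4 * m) + 1 ≡ a + b + (1 + 4 * m)
        arith = solve-∀

        bound : size (tree f) ≤ size (tree d) + size (tree e) + (1 + 4 * n)
        bound = begin
          size (tree d) + size (tree g) + 1
            ≤⟨ +-monoˡ-≤ 1 (+-monoʳ-≤ (size (tree d)) (≤-trans g-size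
                 (+-monoʳ-≤ (size (tree e)) (*-monoʳ-≤ 4 (length-candidates (compared? c k Q)))))) ⟩
          size (tree d) + (size (tree e) + 4 * n) + 1
            ≡⟨ arith (size (tree d)) (size (tree e)) n ⟩
          size (tree d) + size (tree e) + (1 + 4 * n) ∎
          where open ≤-Reasoning

      -- One lemma per suffix of the list of pending roots: at the moment when `k` overtakes the
      -- candidate, exactly the roots after `k` are pending.
      Lemmas : List C → List V → Set
      Lemmas P []      = ⊤
      Lemmas P (k ∷ Q) = (∃[ D ] D ∈ P × Star k Q D) × Lemmas P Q

      lemmas-mono : ∀ Q {P P′} → P ⊆ P′ → Lemmas P Q → Lemmas P′ Q
      lemmas-mono []      P⊆P′ _ = tt
      lemmas-mono (k ∷ Q) P⊆P′ ((D , D∈P , star) , rest) = (D , P⊆P′ D∈P , star) , lemmas-mono Q P⊆P′ rest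

      -- Once some `k` precedes the candidate, its lemma closes that branch after absorption. Only
      -- the branch where `c` stays the candidate goes on, so the size is linear in the length of
      -- `Q` times `n`.
      chain : ∀ Q {P Γ c} → P₀ ⊆ P → Root c → All Root Q → c ∉ Q → Unique Q → Clean Γ Q → Lemmas P Q →
        Σ (Proof P Γ) λ d → Star c Q (conclusion d) × size (tree d) ≤ suc (length Q) * (2 + 4 * n)
      chain [] P₀⊆P rc _ _ _ clean _ =
        let d , star , bound = finish P₀⊆P rc clean
        in  d , star , ≤-trans bound (≤-trans (m≤n+m _ 1) (m≤m+n _ 0))
      chain (k ∷ Q) {P} P₀⊆P rc (rk ∷ rQ) c∉ (k∉Q ∷ unique) clean ((D , D∈P , D-star) , lemmas)
        with chain Q P₀⊆P rc rQ (c∉ ∘ there) unique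
               (clean-∷ rc rk (c∉ ∘ there) (λ k∈Q → All.lookup k∉Q k∈Q refl) (clean-tail clean)) lemmas
      ... | d , d-star , d-size
        with extend P₀⊆P rc rk (c∉ ∘ here) (c∉ ∘ there) (λ k∈Q → All.lookup k∉Q k∈Q refl) clean
               d d-star (assume (inj₂ (∈-++⁺ˡ D∈P))) D-star
      ...   | f , f-star , _ , f-size , _ = f , f-star , (begin
        size (tree f)                                        ≤⟨ f-size ⟩
        size (tree d) + 1 + (1 + 4 * n)                      ≤⟨ +-monoˡ-≤ (1 + 4 * n) (+-monoˡ-≤ 1 d-size) ⟩
        suc (length Q) * (2 + 4 * n) + 1 + (1 + 4 * n)       ≡⟨ arith (suc (length Q) * (2 + 4 * n)) n ⟩
        suc (suc (length Q)) * (2 + 4 * n)                   ∎)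
        where
        open ≤-Reasoning
        arith : ∀ a m → a + 1 + (1 + 4 * m) ≡ (2 + 4 * m) + a
        arith = solve-∀

      -- The first branch is completed first, so that the second finds its lemmas.
      spine : ∀ Q {P Γ c} → P₀ ⊆ P → Root c → All Root Q → c ∉ Q → Unique Q → Clean Γ Q →
        Σ (Proof P Γ) λ d → Star c Q (conclusion d) ×
          (∀ {i y} → i ∈ c ∷ Q → i ⟶ y ∈ Γ₀ → i ⟶ y ∈ conclusion d) ×
          Lemmas (P ++ postorder (tree d)) Q ×
          size (tree d) ≤ suc (length Q) * suc (length Q) * (2 + 4 * n)
      spine [] P₀⊆P rc _ _ _ clean =
        let d , star , bound = finish P₀⊆P rc clean
        in  d , star , (λ { (here refl) → Star.given star }) , tt , ≤-trans bound (≤-trans (m≤n+m _ 1) (m≤m+n _ 0))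
      spine (k ∷ Q) {P} {Γ} {c} P₀⊆P rc (rk ∷ rQ) c∉ (k≢Q ∷ unique) clean
        with spine Q P₀⊆P rc rQ (c∉ ∘ there) unique
               (clean-∷ rc rk (c∉ ∘ there) (λ k∈Q → All.lookup k≢Q k∈Q refl) (clean-tail clean))
      ... | d , d-star , d-given , lemmas , d-size
        -- Here `k` takes over as candidate. The lemmas for `Q` exist by now, so a chain suffices,
        -- and its conclusion is the lemma for `k`.
        with chain Q (∈-++⁺ˡ ∘ P₀⊆P) rk rQ (λ k∈Q → All.lookup k≢Q k∈Q refl) unique
               (clean-map (compared c k Q) rk (λ k∈Q → All.lookup k≢Q k∈Q refl)
                 (λ z∈Z → let rz , _ , _ , z∉Q = compared-spec c k Q z∈Z in rz , z∉Q)
                 (clean-∷ rk rc (λ k∈Q → All.lookup k≢Q k∈Q refl) (c∉ ∘ there) (clean-tail clean)))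
               lemmas
      ...   | e , e-star , e-size
        with extend P₀⊆P rc rk (c∉ ∘ here) (c∉ ∘ there) (λ k∈Q → All.lookup k≢Q k∈Q refl) clean d d-star e e-star
      ...     | f , f-star , keeps , f-size , d⊆f , e⊆f = f , f-star , given ,
        ((conclusion e , ∈-++⁺ʳ P (e⊆f (conclusion∈postorder e)) , e-star) , lemmas-mono Q (++⁺ʳ P d⊆f) lemmas) ,
        (begin
          size (tree f)                                   ≤⟨ f-size ⟩
          size (tree d) + size (tree e) + (1 + 4 * n)     ≤⟨ +-monoˡ-≤ (1 + 4 * n) (+-mono-≤ d-size e-size) ⟩
          q * q * (2 + 4 * n) + q * (2 + 4 * n) + (1 + 4 * n)
            -- The slack completes the square: the three summands become `q * q + 2 * q + 1` times
            -- `2 + 4 * n`.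
            ≤⟨ m≤m+n _ (1 + q * (2 + 4 * n)) ⟩
          q * q * (2 + 4 * n) + q * (2 + 4 * n) + (1 + 4 * n) + (1 + q * (2 + 4 * n))
            ≡⟨ arith q n ⟩
          suc q * suc q * (2 + 4 * n)                     ∎)
        where
        open ≤-Reasoning
        q = suc (length Q)

        given : ∀ {i y} → i ∈ c ∷ k ∷ Q → i ⟶ y ∈ Γ₀ → i ⟶ y ∈ conclusion f
        given (here refl)         iy∈ = keeps iy∈ (inj₁ (d-given (here refl) iy∈))
        given (there (here refl)) iy∈ = keeps iy∈ (inj₂ (Star.given e-star iy∈))
        given (there (there i∈Q)) iy∈ = keeps iy∈ (inj₁ (d-given (there i∈Q) iy∈))

        arith : ∀ q m → q * q * (2 + 4 * m) + q * (2 + 4 * m) + (1 + 4 * m) + (1 + q * (2 + 4 * m)) ≡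
                        suc q * suc q * (2 + 4 * m)
        arith = solve-∀

      -- Start with an arbitrary root as candidate and all other roots pending. No root is then left
      -- to contribute a literal to the star, so only falsified literals remain.
      base : ∃ Root → Σ (Proof P₀ Γ₀) λ d →
        conclusion d ⊆ Γ₀ × (∀ {i y} → Root i → i ⟶ y ∈ Γ₀ → i ⟶ y ∈ conclusion d) ×
        size (tree d) ≤ suc n * suc n * (2 + 4 * n)
      base (u , ru) with spine others id ru (All.tabulate (proj₁ ∘ spec)) (λ u∈ → proj₂ (spec u∈) refl)
                           (filter⁺ other? (allFin⁺ n)) clean
        where
        other? : Decidable (λ j → Root j × u ≢ j)
        other? j = root? j ×-dec ¬? (u ≟ j)
        others = filter other? (allFin n)
        spec : ∀ {j} → j ∈ others → Root j × u ≢ j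
        spec = proj₂ ∘ ∈-filter⁻ other? {xs = allFin n}
        clean : Clean Γ₀ others
        clean = record
          { roots  = λ ri k∈ _ → (λ ik∈ → target ik∈ (proj₁ (spec k∈))) , (λ ki∈ → target ki∈ ri)
          ; leaves = λ rc _ cy∉ → cy∉ , (λ yc∈ → target yc∈ rc) }
      ... | d , star , given , _ , bound = d , upper , (λ {i} ri → given (listed i ri)) ,
        ≤-trans bound (*-monoˡ-≤ (2 + 4 * n) (*-mono-≤ (s≤s (length-candidates other?)) (s≤s (length-candidates other?))))
        where
        other? : Decidable (λ j → Root j × u ≢ j)
        other? j = root? j ×-dec ¬? (u ≟ j)
        upper : conclusion d ⊆ Γ₀
        upper l∈ with Star.upper star l∈
        ... | inj₁ l∈Γ₀ = l∈Γ₀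
        ... | inj₂ (j , rj , u≢j , j∉ , _) = contradiction (∈-filter⁺ other? (∈-allFin j) (rj , u≢j)) j∉
        listed : ∀ i → Root i → i ∈ u ∷ filter other? (allFin n)
        listed i ri with u ≟ i
        ... | yes refl = here refl
        ... | no  u≢i  = there (∈-filter⁺ other? (∈-allFin i) (ri , u≢i))

    -- Counting the transitivity clauses which have not been derived yet

    triples : List (V × V × V)
    triples = cartesianProduct (allFin n) (cartesianProduct (allFin n) (allFin n))

    unlearned? : ∀ P → Decidable (λ ((w , z , u) : V × V × V) → learned w z u ∉ P)
    unlearned? P (w , z , u) = ¬? (learned w z u ∈ᶜ? P)

    unlearned : List C → ℕ
    unlearned P = length (filter (unlearned? P) triples)

    unlearned-mono : ∀ {P P′} → P ⊆ P′ → unlearned P′ ≤ unlearned P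
    unlearned-mono {P} {P′} P⊆P′ = length-filter-mono (unlearned? P) (unlearned? P′) (_∘ P⊆P′) triples

    unlearned-strict : ∀ {P P′ w z u} → P ⊆ P′ → learned w z u ∉ P → learned w z u ∈ P′ → unlearned P′ < unlearned P
    unlearned-strict {P} {P′} {w} {z} {u} P⊆P′ ∉P ∈P′ = length-filter-strict (unlearned? P) (unlearned? P′) (_∘ P⊆P′)
      (∈-cartesianProduct⁺ (∈-allFin w) (∈-cartesianProduct⁺ (∈-allFin z) (∈-allFin u))) ∉P (λ ∉P′ → ∉P′ ∈P′)

    unlearned-≤ : ∀ P → unlearned P ≤ n * (n * n)
    unlearned-≤ P = ≤-trans (List.length-filter (unlearned? P) triples) (≤-reflexive
      (trans (length-cartesianProduct (allFin n) _)
        (cong₂ _*_ |V| (trans (length-cartesianProduct (allFin n) _) (cong₂ _*_ |V| |V|)))))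
      where
      |V| : length (allFin n) ≡ n
      |V| = List.length-tabulate id

    opaque

      -- The first summand pays for an ordering refutation. The second pays for learning a clause:
      -- three adoptions of `4 * n` nodes each, three nodes for the clause itself and three
      -- resolutions.
      budget : ℕ
      budget = suc n * suc n * (2 + 4 * n) + (12 * n + 6)

      budget-def : budget ≡ suc n * suc n * (2 + 4 * n) + (12 * n + 6)
      budget-def = refl

    -- Every clause learned pays for the three refutations which its derivation requires.
    potential : List C → ℕ
    potential P = 3 * budget * unlearned P

    potential-mono : ∀ {P P′} → P ⊆ P′ → potential P′ ≤ potential P
    potential-mono = *-monoʳ-≤ (3 * budget) ∘ unlearned-mono

    -- Amortised size: `b` and the drop in potential together pay for the tree. `gain` is the part
    -- of that drop which is still unspent.
    record Cost (gain : ℕ) (P : List C) (t : Tree (GVar n)) (b : ℕ) : Set where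
      constructor paid
      field
        balance : gain + (size t + potential (P ++ postorder t)) ≤ b + potential P

    open Cost

    cost-enlarge : ∀ {P t t′ b k} → size t′ ≤ size t + k → postorder t ⊆ postorder t′ → Cost 0 P t b → Cost 0 P t′ (b + k)
    cost-enlarge {P} {t} {t′} {b} {k} size≤ t⊆t′ cost = paid (begin
      size t′ + potential (P ++ postorder t′)     ≤⟨ +-mono-≤ size≤ (potential-mono (++⁺ʳ P t⊆t′)) ⟩
      size t + k + potential (P ++ postorder t)   ≡⟨ swap (size t) k _ ⟩
      size t + potential (P ++ postorder t) + k   ≤⟨ +-monoˡ-≤ k (balance cost) ⟩
      b + potential P + k                         ≡⟨ swap b (potential P) k ⟩
      b + k + potential P                         ∎)
      where
      open ≤-Reasoning
      swap : ∀ a b c → a + b + c ≡ a + c + b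
      swap = solve-∀

    -- The potential after the first subtree is the one before the second, so the two balances
    -- telescope. Only the first subtree carries a gain, since the new clause is learned there.
    cost-node : ∀ {gain P t t′ b b′} D v → Cost gain P t b → Cost 0 (P ++ postorder t) t′ b′ →
      Cost gain P (node D v t t′) (b + b′ + 1)
    cost-node {gain} {P} {t} {t′} {b} {b′} D v cost cost′ = paid (begin
      gain + (size t + size t′ + 1 + potential (P ++ postorder t ++ postorder t′ ++ [ D ]))
        ≤⟨ +-monoʳ-≤ gain (+-monoʳ-≤ (size t + size t′ + 1) (potential-mono later)) ⟩
      gain + (size t + size t′ + 1 + potential ((P ++ postorder t) ++ postorder t′))
        ≡⟨ arith₁ gain (size t) (size t′) _ ⟩
      gain + size t + 1 + (size t′ + potential ((P ++ postorder t) ++ postorder t′))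
        ≤⟨ +-monoʳ-≤ (gain + size t + 1) (balance cost′) ⟩
      gain + size t + 1 + (b′ + potential (P ++ postorder t))
        ≡⟨ arith₂ gain (size t) b′ _ ⟩
      gain + (size t + potential (P ++ postorder t)) + (b′ + 1)
        ≤⟨ +-monoˡ-≤ (b′ + 1) (balance cost) ⟩
      b + potential P + (b′ + 1)
        ≡⟨ arith₃ b b′ _ ⟩
      b + b′ + 1 + potential P ∎)
      where
      open ≤-Reasoning
      later : (P ++ postorder t) ++ postorder t′ ⊆ P ++ postorder t ++ postorder t′ ++ [ D ]
      later = [ ++⁺ʳ P ∈-++⁺ˡ , ∈-++⁺ʳ P ∘ ∈-++⁺ʳ (postorder t) ∘ ∈-++⁺ˡ ]′ ∘ ∈-++⁻ (P ++ postorder t)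
      arith₁ : ∀ g s s′ p → g + (s + s′ + 1 + p) ≡ g + s + 1 + (s′ + p)
      arith₁ = solve-∀
      arith₂ : ∀ g s b p → g + s + 1 + (b + p) ≡ g + (s + p) + (b + 1)
      arith₂ = solve-∀
      arith₃ : ∀ b b′ p → b + p + (b′ + 1) ≡ b + b′ + 1 + p
      arith₃ = solve-∀

    fork : ∀ {P Γ a b gain k k′} → a ≢ b → Fresh Γ a b →
      (d : Proof P (a ⟶ b ∷ Γ)) → a ⟶ b ∈ conclusion d → conclusion d ⊆ a ⟶ b ∷ Γ → Cost gain P (tree d) k →
      (e : Proof (P ++ postorder (tree d)) (b ⟶ a ∷ Γ)) → b ⟶ a ∈ conclusion e → conclusion e ⊆ b ⟶ a ∷ Γ →
      Cost 0 (P ++ postorder (tree d)) (tree e) k′ →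
      Σ (Proof P Γ) λ f → conclusion f ⊆ Γ ×
        (∀ {l} → l ∈ Γ → l ∈ conclusion d ⊎ l ∈ conclusion e → l ∈ conclusion f) ×
        Cost gain P (tree f) (k + k′ + 1)
    fork {P} {Γ} {a} {b} a≢b fresh d ab∈d d⊆ d-cost e ba∈e e⊆ e-cost =
      branch a≢b fresh d ab∈d ba∉d e ba∈e ab∉e , upper , keeps , cost-node {P = P} _ _ d-cost e-cost
      where
      ba∉d : b ⟶ a ∉ conclusion d
      ba∉d ba∈d with d⊆ ba∈d
      ... | here eq    = a≢b (sym (proj₁ (⟶-injective eq)))
      ... | there ba∈Γ = proj₂ fresh ba∈Γ

      ab∉e : a ⟶ b ∉ conclusion e
      ab∉e ab∈e with e⊆ ab∈e
      ... | here eq    = a≢b (proj₁ (⟶-injective eq))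
      ... | there ab∈Γ = proj₁ fresh ab∈Γ

      upper : resolvent (a ⟶ b) (conclusion d) (conclusion e) ⊆ Γ
      upper l∈ with ∈-resolvent⁻ a≢b (conclusion d) (conclusion e) l∈
      ... | inj₁ (l∈d , l≢ab) = [ (λ eq → contradiction eq l≢ab) , id ]′ (toSum (d⊆ l∈d))
      ... | inj₂ (l∈e , l≢ba) = [ (λ eq → contradiction eq l≢ba) , id ]′ (toSum (e⊆ l∈e))

      keeps : ∀ {l} → l ∈ Γ → l ∈ conclusion d ⊎ l ∈ conclusion e →
        l ∈ resolvent (a ⟶ b) (conclusion d) (conclusion e)
      keeps l∈Γ (inj₁ l∈d) = ∈-resolvent⁺ˡ (conclusion d) (conclusion e) l∈d (λ { refl → proj₁ fresh l∈Γ })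
      keeps l∈Γ (inj₂ l∈e) = ∈-resolvent⁺ʳ a≢b (conclusion d) (conclusion e) l∈e (λ { refl → proj₂ fresh l∈Γ })

    -- The roots vs become children of the root u, by the decisions E, and their children must follow.
    module Merge {Γ : C} (σ : State Γ) (E : C) (u : V) (vs : List V)
      (u-root : State.Root σ u) (u∉vs : u ∉ vs)
      (vs-root : ∀ {v} → v ∈ vs → State.Root σ v × u ⟶ v ∈ E)
      (E-target : ∀ {i j} → i ⟶ j ∈ E → ¬ State.Root σ j ⊎ j ∈ vs) where

      open State σ

      orphan? : Decidable (λ z → ¬ Root z × parent z ∈ vs × u ⟶ z ∉ E ++ Γ)
      orphan? z = ¬? (root? z) ×-dec (parent z ∈ᵥ? vs) ×-dec ¬? (u ⟶ z ∈? (E ++ Γ))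

      orphans : List V
      orphans = filter orphan? (allFin n)

      orphan-spec : ∀ {z} → z ∈ orphans → ¬ Root z × parent z ∈ vs × u ⟶ z ∉ E ++ Γ
      orphan-spec = proj₂ ∘ ∈-filter⁻ orphan? {xs = allFin n}

      Path : C
      Path = map (u ⟶_) orphans ++ E ++ Γ

      Root′ : V → Set
      Root′ y = Root y × y ∉ vs

      former : ∀ {y} → ¬ Root′ y → y ∉ vs → ¬ Root y
      former ¬ry y∉vs ry = ¬ry (ry , y∉vs)

      target′ : ∀ {i j} → i ⟶ j ∈ E ++ Γ → ¬ Root′ j
      target′ ij∈ (rj , j∉vs) with ∈-++⁻ E ij∈
      ... | inj₁ ij∈E = [ (λ ¬rj → ¬rj rj) , j∉vs ]′ (E-target ij∈E)
      ... | inj₂ ij∈Γ = target ij∈Γ rj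

      parent′ : V → V
      parent′ y with y ∈ᵥ? vs | parent y ∈ᵥ? vs
      ... | yes _ | _     = u
      ... | no  _ | yes _ = u
      ... | no  _ | no  _ = parent y

      merged : State Path
      merged = record
        { Root        = Root′
        ; root?       = λ y → root? y ×-dec ¬? (y ∈ᵥ? vs)
        ; target      = target″
        ; parent      = parent′
        ; parent-root = root
        ; parent-edge = edge
        }
        where
        target″ : ∀ {i j} → i ⟶ j ∈ Path → ¬ Root′ j
        target″ ij∈ rj with ∈-++⁻ (map (u ⟶_) orphans) ij∈
        ... | inj₂ ij∈′ = target′ ij∈′ rj
        ... | inj₁ ij∈′ with ∈-map⁻ (u ⟶_) ij∈′
        ...   | z , z∈ , eq =
          proj₁ (orphan-spec z∈) (subst Root (proj₂ (⟶-injective eq)) (proj₁ rj))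

        root : ∀ {y} → ¬ Root′ y → Root′ (parent′ y)
        root {y} ¬ry with y ∈ᵥ? vs | parent y ∈ᵥ? vs
        ... | yes _    | _     = u-root , u∉vs
        ... | no  _    | yes _ = u-root , u∉vs
        ... | no  y∉vs | no p∉ = parent-root (former ¬ry y∉vs) , p∉

        edge : ∀ {y} → ¬ Root′ y → parent′ y ⟶ y ∈ Path
        edge {y} ¬ry with y ∈ᵥ? vs | parent y ∈ᵥ? vs
        ... | yes y∈vs | _ = ∈-++⁺ʳ (map (u ⟶_) orphans) (∈-++⁺ˡ (proj₂ (vs-root y∈vs)))
        ... | no  y∉vs | no _ = ∈-++⁺ʳ (map (u ⟶_) orphans) (∈-++⁺ʳ E (parent-edge (former ¬ry y∉vs)))
        ... | no  y∉vs | yes p∈ with u ⟶ y ∈? (E ++ Γ)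
        ...   | yes uy∈ = ∈-++⁺ʳ (map (u ⟶_) orphans) uy∈
        ...   | no  uy∉ = ∈-++⁺ˡ (∈-map⁺ (u ⟶_)
                            (∈-filter⁺ orphan? (∈-allFin y) (former ¬ry y∉vs , p∈ , uy∉)))

      -- Each orphan `z` is absorbed by `u` through the triangle of `parent z`, `z`, `u`, whose
      -- other arcs lie in `Γ` and `E`. This triangle need not be available, hence `derive-△`. Arcs
      -- leaving `vs` may be lost, as these are no longer roots.
      adopt : ∀ {P k} (d : Proof P Path) → conclusion d ⊆ Path →
        (∀ {i y} → Root′ i → i ⟶ y ∈ Path → i ⟶ y ∈ conclusion d) → Cost 0 P (tree d) k →
        Σ (Proof P (E ++ Γ)) λ f → conclusion f ⊆ E ++ Γ ×
          (∀ {i y} → Root i → i ∉ vs → i ⟶ y ∈ E ++ Γ → i ⟶ y ∈ conclusion f) × Cost 0 P (tree f) (k + 4 * n)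
      adopt {P} d upper given cost
        with absorb u (_∈ E ++ Γ) orphans (filter⁺ orphan? (allFin⁺ n)) separate close d
               (λ z∈ → given (u-root , u∉vs) (∈-++⁺ˡ (∈-map⁺ (u ⟶_) z∈)))
               (Sum.swap ∘ ∈-++⁻ (map (u ⟶_) orphans) ∘ upper)
        where
        separate : ∀ {z} → z ∈ orphans → u ≢ z × Fresh (E ++ Γ) u z × u ⟶ z ∉ E ++ Γ × z ⟶ u ∉ E ++ Γ
        separate z∈ with orphan-spec z∈
        ... | ¬rz , _ , uz∉ = (λ { refl → ¬rz u-root }) , (uz∉ , zu∉) , uz∉ , zu∉
          where zu∉ = λ zu∈ → target′ zu∈ (u-root , u∉vs)

        close : ∀ {z Z′ P′} → z ∈ orphans → P ⊆ P′ → Σ (Proof P′ (z ⟶ u ∷ map (u ⟶_) Z′ ++ E ++ Γ)) λ e →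
          z ⟶ u ∈ conclusion e ×
          (∀ {l} → l ∈ conclusion e → l ≡ z ⟶ u ⊎ l ∈ E ++ Γ ⊎ l ∈ map (u ⟶_) Z′) × size (tree e) ≤ 3
        close {z} {Z′} {P′} z∈ _ with orphan-spec z∈
        ... | ¬rz , p∈vs , _ with derive-△ P′ (z ⟶ u ∷ map (u ⟶_) Z′ ++ E ++ Γ) {parent z} {z} {u}
            ((λ p≡z → ¬rz (subst Root p≡z (parent-root ¬rz))) , (λ { refl → ¬rz u-root }) , (λ { refl → u∉vs p∈vs }))
        ...   | e , △⊆e , e⊆ , e-size = e , △⊆e (there (here refl)) , bounded ∘ e⊆ , e-size
          where
          bounded : ∀ {l} → l ∈ △ (parent z) z u ⊎ l ∈ z ⟶ u ∷ map (u ⟶_) Z′ ++ E ++ Γ →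
            l ≡ z ⟶ u ⊎ l ∈ E ++ Γ ⊎ l ∈ map (u ⟶_) Z′
          bounded (inj₁ (here refl))                 = inj₂ (inj₁ (∈-++⁺ʳ E (parent-edge ¬rz)))
          bounded (inj₁ (there (here eq)))           = inj₁ eq
          bounded (inj₁ (there (there (here refl)))) = inj₂ (inj₁ (∈-++⁺ˡ (proj₂ (vs-root p∈vs))))
          bounded (inj₂ (here eq))                   = inj₁ eq
          bounded (inj₂ (there l∈))                  = inj₂ (Sum.swap (∈-++⁻ (map (u ⟶_) Z′) l∈))
      ... | f , f⊆ , keeps , f-size , d⊆f = f , f⊆ ,
        (λ ri i∉vs iy∈ → keeps iy∈ (given (ri , i∉vs) (∈-++⁺ʳ (map (u ⟶_) orphans) iy∈))) ,
        cost-enlarge {P} {tree d} (≤-trans f-size (+-monoʳ-≤ (size (tree d)) (*-monoʳ-≤ 4 (length-candidates orphan?)))) d⊆f cost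

    -- `given` is the invariant that keeps resolution proper: the decision leading to a side branch
    -- is an arc from a root, so its literal is present in the clause refuted there.
    record Refuted {Γ : C} (σ : State Γ) (P : List C) (gain b : ℕ) : Set where
      field
        proof : Proof P Γ
        upper : conclusion proof ⊆ Γ
        given : ∀ {i y} → State.Root σ i → i ⟶ y ∈ Γ → i ⟶ y ∈ conclusion proof
        cost  : Cost gain P (tree proof) b

    -- Learning one missing transitivity clause.

    module _ {Γ : C} (σ : State Γ) (P : List C) where

      open State σ

      Missing : V → V → V → Set
      Missing w z u = Needed w z u × learned w z u ∉ P × Fresh Γ (r w z u) (s w z u)

      missing? : Dec (∃[ w ] ∃[ z ] ∃[ u ] Missing w z u)
      missing? = any? λ w → any? λ z → any? λ u →
        needed? w z u ×-dec ¬? (learned w z u ∈ᶜ? P) ×-dec fresh? Γ (r w z u) (s w z u)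

      nothing-missing : ¬ (∃[ w ] ∃[ z ] ∃[ u ] Missing w z u) → ∀ {w z u} → Needed w z u → Available P Γ w z u
      nothing-missing none {w} {z} {u} need with learned w z u ∈ᶜ? P
      ... | yes l∈P = available (distinct need) (inj₁ l∈P)
      ... | no  l∉P = available (distinct need) (inj₂ λ fresh → none (w , z , u , need , l∉P , fresh))

      module Learn {w z u : V} (missing : Missing w z u)
        (refute : ∀ {Γ′} (σ′ : State Γ′) P′ → unlearned P′ < unlearned P → ∃ (State.Root σ′) → Refuted σ′ P′ 0 budget) where

        private
          need = proj₁ missing
          dist = distinct need
          w≢z  = proj₁ dist
          z≢u  = proj₁ (proj₂ dist)
          w≢u  = proj₂ (proj₂ dist)
          wr   = Needed.w-root need
          ur   = Needed.u-root need

        -- The subtree that contains the new clause, with the freed `3 * budget` recorded as gain.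
        -- `M` describes literals certain to survive, among which the next resolution finds its
        -- pivot.
        record Lesson (E : C) (k : ℕ) (M : L → Set) : Set where
          field
            proof  : Proof P E
            upper  : conclusion proof ⊆ E
            given  : ∀ {l} → M l → l ∈ conclusion proof
            cost   : Cost (3 * budget) P (tree proof) k
            learnt : learned w z u ∈ postorder (tree proof)

        record Side (E : C) (P′ : List C) (M : L → Set) : Set where
          field
            proof : Proof P′ E
            upper : conclusion proof ⊆ E
            given : ∀ {l} → M l → l ∈ conclusion proof
            cost  : Cost 0 P′ (tree proof) (budget + 4 * n)

        progress : ∀ {P′} → learned w z u ∈ P′ → unlearned (P ++ P′) < unlearned P
        progress ∈P′ = unlearned-strict ∈-++⁺ˡ (proj₁ (proj₂ missing)) (∈-++⁺ʳ P ∈P′)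

        -- `E` adds to `Γ` only literals of the triangle, and the guard is none of these, so it is
        -- still undecided at `E`. The new clause lowers the count of unlearned triples by at least
        -- one, whence the gain.
        lesson : ∀ {E} → (∀ {l} → l ∈ E → l ∈ △ w z u ⊎ l ∈ Γ) → △ w z u ⊆ E → Lesson E 3 (_∈ △ w z u)
        lesson {E} E⊆ △⊆E = record
          { proof  = proof
          ; upper  = △⊆E ∘ learned⊆△ dist
          ; given  = △⊆learned dist
          ; cost   = paid cost
          ; learnt = learnt
          }
          where
          fresh = proj₂ (proj₂ missing)

          fresh-E : ∀ {l} → l ∉ Γ → l ∉ △ w z u → l ∉ E
          fresh-E l∉Γ l∉△ = [ l∉△ , l∉Γ ]′ ∘ E⊆

          proof : Proof P E
          proof = learn dist (fresh-E (proj₁ fresh) (rs∉△ dist) , fresh-E (proj₂ fresh) (sr∉△ dist))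

          learnt : learned w z u ∈ postorder (tree proof)
          learnt = conclusion∈postorder proof

          open ≤-Reasoning

          arith : ∀ k m → k + (3 + k * m) ≡ 3 + k * suc m
          arith = solve-∀

          cost : 3 * budget + (size (tree proof) + potential (P ++ postorder (tree proof))) ≤ 3 + potential P
          cost = begin
            3 * budget + (3 + potential (P ++ postorder (tree proof)))
              ≡⟨ arith (3 * budget) (unlearned (P ++ postorder (tree proof))) ⟩
            3 + 3 * budget * suc (unlearned (P ++ postorder (tree proof)))
              ≤⟨ +-monoʳ-≤ 3 (*-monoʳ-≤ (3 * budget) (progress learnt)) ⟩
            3 + potential P ∎

        combine : ∀ {E a b k M M′} → a ≢ b → Fresh E a b → Lesson (a ⟶ b ∷ E) k M → M (a ⟶ b) →
          (∀ P′ → unlearned P′ < unlearned P → Side (b ⟶ a ∷ E) P′ M′) → M′ (b ⟶ a) →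
          Lesson E (k + (budget + 4 * n) + 1) (λ l → l ∈ E × (M l ⊎ M′ l))
        combine {E} {M = M} {M′} a≢b fresh d ab∈M side ba∈M′ = record
          { proof  = proj₁ f
          ; upper  = proj₁ (proj₂ f)
          ; given  = λ { (l∈E , c) → proj₁ (proj₂ (proj₂ f)) l∈E (Sum.map d.given e.given c) }
          ; cost   = proj₂ (proj₂ (proj₂ f))
          ; learnt = ∈-++⁺ˡ d.learnt
          }
          where
          module d = Lesson d
          module e = Side (side (P ++ postorder (tree d.proof)) (progress d.learnt))
          f = fork a≢b fresh d.proof (d.given ab∈M) d.upper d.cost e.proof (e.given ba∈M′) e.upper e.cost

        Leading : List V → C → L → Set
        Leading vs E l = ∃[ i ] ∃[ y ] Root i × i ∉ vs × l ≡ i ⟶ y × l ∈ E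

        -- A side branch: the decisions `E` put `vs` below `c`, the merged state is refuted
        -- recursively, and `adopt` undoes the extra decisions about orphans.
        explore : ∀ E c vs → Root c → c ∉ vs → (∀ {v} → v ∈ vs → Root v × c ⟶ v ∈ E) →
          (∀ {i j} → i ⟶ j ∈ E → ¬ Root j ⊎ j ∈ vs) → ∀ P′ → unlearned P′ < unlearned P →
          Side (E ++ Γ) P′ (Leading vs (E ++ Γ))
        explore E c vs rc c∉vs vs-root E-target P′ less = record
          { proof = proj₁ f
          ; upper = proj₁ (proj₂ f)
          ; given = λ { (i , y , ri , i∉vs , refl , iy∈) → proj₁ (proj₂ (proj₂ f)) ri i∉vs iy∈ }
          ; cost  = proj₂ (proj₂ (proj₂ f))
          }
          where
          open Merge σ E c vs rc c∉vs vs-root E-target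
          module e = Refuted (refute merged P′ less (c , rc , c∉vs))
          f = adopt e.proof e.upper e.given e.cost

        -- The gain pays for the three side refutations, and what is left of `k`, namely
        -- `12 * n + 6`, fits into `budget`.
        settle : ∀ {t k} → k ≤ 3 * (budget + 4 * n) + 6 → Cost (3 * budget) P t k → Cost 0 P t budget
        settle {t} {k} k≤ cost = paid (+-cancelˡ-≤ (3 * budget) _ _ (begin
          3 * budget + (size t + potential (P ++ postorder t))   ≤⟨ balance cost ⟩
          k + potential P                                        ≤⟨ +-monoˡ-≤ (potential P) k≤ ⟩
          3 * (budget + 4 * n) + 6 + potential P                 ≡⟨ arith budget n (potential P) ⟩
          3 * budget + (12 * n + 6 + potential P)                ≤⟨ +-monoʳ-≤ (3 * budget) (+-monoˡ-≤ (potential P) overhead) ⟩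
          3 * budget + (budget + potential P)                    ∎))
          where
          open ≤-Reasoning
          overhead : 12 * n + 6 ≤ budget
          overhead = ≤-trans (m≤n+m (12 * n + 6) (suc n * suc n * (2 + 4 * n))) (≤-reflexive (sym budget-def))
          arith : ∀ b m p → 3 * (b + 4 * m) + 6 + p ≡ 3 * b + (12 * m + 6 + p)
          arith = solve-∀

        conclude : ∀ {k M} → k ≤ 3 * (budget + 4 * n) + 6 → Lesson Γ k M →
          (∀ {i y} → Root i → i ⟶ y ∈ Γ → M (i ⟶ y)) → Refuted σ P 0 budget
        conclude k≤ d given = record
          { proof = Lesson.proof d
          ; upper = Lesson.upper d
          ; given = λ ri iy∈ → Lesson.given d (given ri iy∈)
          ; cost  = settle k≤ (Lesson.cost d)
          }

        -- The decisions z ⟶ u, w ⟶ z, u ⟶ w lead to the new lemma, and the opposite of the last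
        -- decision always makes one root precede the others involved.
        learn-roots : Root z → Refuted σ P 0 budget
        learn-roots zr = conclude (≤-reflexive (arith (budget + 4 * n))) lesson₀ given
          where
          lesson₃ : Lesson (u ⟶ w ∷ w ⟶ z ∷ z ⟶ u ∷ Γ) 3 (_∈ △ w z u)
          lesson₃ = lesson
            (λ { (here eq)                  → inj₁ (there (there (here eq)))
               ; (there (here eq))          → inj₁ (here eq)
               ; (there (there (here eq)))  → inj₁ (there (here eq))
               ; (there (there (there l∈))) → inj₂ l∈ })
            (λ { (here eq)                  → there (here eq)
               ; (there (here eq))          → there (there (here eq))
               ; (there (there (here eq)))  → here eq })

          w∉ : w ∉ z ∷ u ∷ []
          w∉ (here w≡z)         = w≢z w≡z
          w∉ (there (here w≡u)) = w≢u w≡u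

          z∉ : z ∉ w ∷ u ∷ []
          z∉ (here z≡w)         = w≢z (sym z≡w)
          z∉ (there (here z≡u)) = z≢u z≡u

          u∉ : u ∉ z ∷ []
          u∉ (here u≡z) = z≢u (sym u≡z)

          fresh₂ : Fresh (w ⟶ z ∷ z ⟶ u ∷ Γ) u w
          fresh₂ =
            (λ { (here eq)           → w≢u (sym (proj₁ (⟶-injective eq)))
               ; (there (here eq))   → w≢u (proj₂ (⟶-injective eq))
               ; (there (there uw∈)) → target uw∈ wr }) ,
            (λ { (here eq)           → z≢u (sym (proj₂ (⟶-injective eq)))
               ; (there (here eq))   → w≢z (proj₁ (⟶-injective eq))
               ; (there (there wu∈)) → target wu∈ ur })

          lesson₂ : Lesson (w ⟶ z ∷ z ⟶ u ∷ Γ) _ _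
          lesson₂ = combine (w≢u ∘ sym) fresh₂ lesson₃ (there (there (here refl)))
            (explore (w ⟶ u ∷ w ⟶ z ∷ z ⟶ u ∷ []) w (z ∷ u ∷ []) wr w∉
              (λ { (here refl) → zr , there (here refl) ; (there (here refl)) → ur , here refl })
              (λ { (here eq)                 → inj₂ (there (here (proj₂ (⟶-injective eq))))
                 ; (there (here eq))         → inj₂ (here (proj₂ (⟶-injective eq)))
                 ; (there (there (here eq))) → inj₂ (there (here (proj₂ (⟶-injective eq)))) }))
            (w , u , wr , w∉ , refl , here refl)

          fresh₁ : Fresh (z ⟶ u ∷ Γ) w z
          fresh₁ =
            (λ { (here eq) → w≢z (proj₁ (⟶-injective eq)) ; (there wz∈) → target wz∈ zr }) ,
            (λ { (here eq) → w≢u (proj₂ (⟶-injective eq)) ; (there zw∈) → target zw∈ wr })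

          lesson₁ : Lesson (z ⟶ u ∷ Γ) _ _
          lesson₁ = combine w≢z fresh₁ lesson₂ (here refl , inj₁ (here refl))
            (explore (z ⟶ w ∷ z ⟶ u ∷ []) z (w ∷ u ∷ []) zr z∉
              (λ { (here refl) → wr , here refl ; (there (here refl)) → ur , there (here refl) })
              (λ { (here eq)         → inj₂ (here (proj₂ (⟶-injective eq)))
                 ; (there (here eq)) → inj₂ (there (here (proj₂ (⟶-injective eq)))) }))
            (z , w , zr , z∉ , refl , here refl)

          lesson₀ : Lesson Γ _ _
          lesson₀ = combine z≢u ((λ zu∈ → target zu∈ ur) , (λ uz∈ → target uz∈ zr)) lesson₁
            (here refl , inj₁ (there (here refl) , inj₁ (there (here refl))))
            (explore (u ⟶ z ∷ []) u (z ∷ []) ur u∉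
              (λ { (here refl) → zr , here refl })
              (λ { (here eq) → inj₂ (here (proj₂ (⟶-injective eq))) }))
            (u , z , ur , u∉ , refl , here refl)

          given : ∀ {i y} → Root i → i ⟶ y ∈ Γ → _
          -- The outermost alternative `u ⟶ z` keeps the arcs of every root except `z`, which became
          -- a child of `u`. Those of `z` come from the alternative `z ⟶ w`, where `z` leads.
          given {i} {y} ri iy∈ with i ≟ z
          ... | no  i≢z  = iy∈ , inj₂ (i , y , ri , (λ { (here i≡z) → i≢z i≡z }) , refl , there iy∈)
          ... | yes refl = iy∈ , inj₁ (there iy∈ , inj₂ (z , y , zr , z∉ , refl , there (there iy∈)))

          arith : ∀ b → 3 + b + 1 + b + 1 + b + 1 ≡ 3 * b + 6
          arith = solve-∀

        -- The arc `w ⟶ z` is already decided, so the decisions `z ⟶ u` and `u ⟶ w` suffice. The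
        -- alternative `w ⟶ u` puts `u` below `w`; the alternative `u ⟶ z` only adds an arc into a
        -- leaf and keeps all roots.
        learn-leaf : ¬ Root z → parent z ≡ w → u ⟶ z ∉ Γ → Refuted σ P 0 budget
        learn-leaf ¬zr refl uz∉ = conclude enough lesson₀
          (λ {i} {y} ri iy∈ → iy∈ , inj₂ (i , y , ri , (λ ()) , refl , there iy∈))
          where
          lesson₂ : Lesson (u ⟶ w ∷ z ⟶ u ∷ Γ) 3 (_∈ △ w z u)
          lesson₂ = lesson
            (λ { (here eq)                 → inj₁ (there (there (here eq)))
               ; (there (here eq))         → inj₁ (there (here eq))
               ; (there (there l∈))        → inj₂ l∈ })
            (λ { (here refl)               → there (there (parent-edge ¬zr))
               ; (there (here eq))         → there (here eq)
               ; (there (there (here eq))) → here eq })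

          w∉ : w ∉ u ∷ []
          w∉ (here w≡u) = w≢u w≡u

          fresh₁ : Fresh (z ⟶ u ∷ Γ) u w
          fresh₁ =
            (λ { (here eq) → w≢u (proj₂ (⟶-injective eq)) ; (there uw∈) → target uw∈ wr }) ,
            (λ { (here eq) → w≢z (proj₁ (⟶-injective eq)) ; (there wu∈) → target wu∈ ur })

          lesson₁ : Lesson (z ⟶ u ∷ Γ) _ _
          lesson₁ = combine (w≢u ∘ sym) fresh₁ lesson₂ (there (there (here refl)))
            (explore (w ⟶ u ∷ z ⟶ u ∷ []) w (u ∷ []) wr w∉
              (λ { (here refl) → ur , here refl })
              (λ { (here eq)         → inj₂ (here (proj₂ (⟶-injective eq)))
                 ; (there (here eq)) → inj₂ (here (proj₂ (⟶-injective eq))) }))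
            (w , u , wr , w∉ , refl , here refl)

          lesson₀ : Lesson Γ _ _
          lesson₀ = combine z≢u ((λ zu∈ → target zu∈ ur) , uz∉) lesson₁
            (here refl , inj₁ (there (here refl)))
            (explore (u ⟶ z ∷ []) u [] ur (λ ()) (λ ())
              (λ { (here eq) → inj₁ (λ rj → ¬zr (subst Root (proj₂ (⟶-injective eq)) rj)) }))
            (u , z , ur , (λ ()) , refl , here refl)

          arith : ∀ b → 3 + b + 1 + b + 1 + (b + 1) ≡ 3 * b + 6
          arith = solve-∀

          -- Two of the three side refutations paid for are used.
          enough : 3 + (budget + 4 * n) + 1 + (budget + 4 * n) + 1 ≤ 3 * (budget + 4 * n) + 6
          enough = ≤-trans (m≤m+n _ (budget + 4 * n + 1)) (≤-reflexive (arith (budget + 4 * n)))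

        learn-missing : Refuted σ P 0 budget
        learn-missing with Needed.cases need
        ... | inj₁ (zr , _)             = learn-roots zr
        ... | inj₂ (¬zr , refl , uz∉)   = learn-leaf ¬zr refl uz∉

    -- The recursion and the polynomial bound.

    -- Side branches are refuted only after a new clause has been learned, so the number of
    -- unlearned triples bounds the depth of the recursion. The total size is controlled by the
    -- potential.
    refute : ∀ fuel {Γ} (σ : State Γ) P → unlearned P ≤ fuel → ∃ (State.Root σ) → Refuted σ P 0 budget
    refute fuel σ P enough root with missing? σ P
    ... | no none = record { proof = d ; upper = upper ; given = given ; cost = paid (+-mono-≤ small (potential-mono ∈-++⁺ˡ)) }
      where
      result = Base.base σ (nothing-missing σ P none) root
      d     = proj₁ result
      upper = proj₁ (proj₂ result)
      given = λ {i} {y} → proj₁ (proj₂ (proj₂ result)) {i} {y}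
      small : size (tree d) ≤ budget
      small = ≤-trans (proj₂ (proj₂ (proj₂ result))) (≤-trans (m≤m+n _ (12 * n + 6)) (≤-reflexive (sym budget-def)))
    refute zero       σ P enough root | yes (w , z , u , missing) =
      -- Adding the missing clause to `P` would lower a count that is already zero.
      contradiction (<-≤-trans (unlearned-strict {P} {learned w z u ∷ P} there (proj₁ (proj₂ missing)) (here refl)) enough) λ ()
    refute (suc fuel) σ P enough root | yes (w , z , u , missing) =
      Learn.learn-missing σ P missing λ σ′ P′ less → refute fuel σ′ P′ (s≤s⁻¹ (<-≤-trans less enough))

    -- Nothing is decided, so every vertex is a root; the conclusion refuted here is contained in
    -- the empty clause.
    initial : State []
    initial = record
      { Root        = λ _ → ⊤
      ; root?       = λ _ → yes tt
      ; target      = λ ()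
      ; parent      = id
      ; parent-root = λ _ → tt
      ; parent-edge = λ ¬root → contradiction tt ¬root
      }

    refutation : V → Σ (Tree (GVar n)) λ t → PoolRefutation (GGT n r s) t × size t ≤ budget + 3 * budget * (n * (n * n))
    refutation v = tree proof , (trans (concludes proof) (⊆[]⇒≡[] upper) , valid proof , regular proof) , (begin
      size (tree proof)                                        ≤⟨ m≤m+n _ _ ⟩
      size (tree proof) + potential (postorder (tree proof))   ≤⟨ balance cost ⟩
      budget + potential []                                    ≤⟨ +-monoʳ-≤ budget (*-monoʳ-≤ (3 * budget) (unlearned-≤ [])) ⟩
      budget + 3 * budget * (n * (n * n))                      ∎)
      where
      open ≤-Reasoning
      open Refuted (refute (unlearned []) initial [] ≤-refl (v , tt))
      ⊆[]⇒≡[] : ∀ {D : C} → D ⊆ [] → D ≡ []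
      ⊆[]⇒≡[] {[]}    _  = refl
      ⊆[]⇒≡[] {l ∷ D} D⊆ = contradiction (D⊆ (here refl)) λ ()

theorem1 : Σ Poly λ p → (n : ℕ) → 2 ≤ n → (r s : Guard n) → GuardConditions n r s →
    Σ (Tree (GVar n)) λ T → PoolRefutation (GGT n r s) T × size T ≤ eval p n
-- The coefficients of `b + 3 * b * n ^ 3`, where `b` is the budget
-- `4 * n ^ 3 + 10 * n ^ 2 + 20 * n + 8`.
theorem1 = 8 ∷ 20 ∷ 10 ∷ 28 ∷ 60 ∷ 30 ∷ 12 ∷ [] , λ
  { zero ()
  ; (suc n) _ r s guards →
      let t , refutes , bound = Guarded.refutation r s guards zero
      in  t , refutes , ≤-trans bound (≤-reflexive
            (trans (cong (λ b → b + 3 * b * _) (Guarded.budget-def r s guards)) (horner (suc n)))) }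
  where
  horner : ∀ n → let b = suc n * suc n * (2 + 4 * n) + (12 * n + 6) in
    b + 3 * b * (n * (n * n)) ≡
    8 + n * (20 + n * (10 + n * (28 + n * (60 + n * (30 + n * (12 + n * 0))))))
  horner = solve-∀
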